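{- Let $n\ge1$. For every lattice path $\pi\in\mathcal L_{n,n}$ we have $\operatorname{sw}(\pi)=\zeta_C(\pi)$. In particular the sweep map $\operatorname{sw}:\mathcal L_{n,n}\to\mathcal B_{2n}$ is a bijection.
   Context: $\mathcal L_{n,n}$: words in $\{N,E\}$ with $n$ letters of each kind; $\mathcal B_{2n}$: words of length $2n$ all of whose prefixes have at least as many $N$'s as $E$'s. For an integer vector $a=(a_1,\dots,a_n)$ and $j\ge0$: $\overrightarrow{S}^+_j(a)$ reads $a$ left to right writing $N$ for entries equal to $j$ and $E$ for entries equal to $j+1$; $\overleftarrow{S}^+_j(a)$ reads right to left; $\overrightarrow{S}^-_j(a),\overleftarrow{S}^-_j(a)$ likewise with $N$ for entries $-j$ and $E$ for entries $-j-1$. For $\pi\in\mathcal L_{n,n}$ let $\lambda_i$ be the number of East steps before the $i$-th North step, $\mu_i=(n+1-i)-\lambda_{n+1-i}$, and $\zeta_C(\pi)=\overleftarrow{S}^-_n(\mu)\overrightarrow{S}^+_n(\mu)\cdots\overleftarrow{S}^-_0(\mu)\overrightarrow{S}^+_0(\mu)$. Sweep map: write $\pi=s_1s_2\cdots s_{2n}$, $s_i\in\{N,E\}$. Set $\ell_1=0$ and $\ell_{i+1}=\ell_i+2n+1$ if $s_i=N$, $\ell_{i+1}=\ell_i-2n$ if $s_i=E$. Form a collection $X$ of $2n$ labelled steps: for each $i$ with $\ell_i<0$ add $(s_i,\ell_i)$; for each $i$ with $\ell_i>0$ add $(s_{i-1},-\ell_i)$; for $i=1$ (the step labelled $0$)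 add $(s_{2n},-n)$. Then $\operatorname{sw}(\pi)$ is the word obtained by repeatedly choosing the element $(s,\ell)\in X$ with minimal label $\ell$, writing down $s$, and removing $(s,\ell)$ from $X$, until $X$ is empty. -}

module Defs where

open import Data.Nat using (ℕ; zero; suc; _+_; _*_; _≤_)
open import Data.Integer as ℤ using (ℤ; +_; _-_; -_; _<?_; _≤?_)
open import Data.List using (List; []; _∷_; _++_; take; length; reverse; concatMap; map; downFrom; upTo; zipWith)
open import Data.Product using (_×_; _,_; proj₁; proj₂)
open import Relation.Nullary using (yes; no)

data Step : Set where
  N E : Step

open import Relation.Binary.PropositionalEquality using (_≡_)

count : Step → List Step → ℕ
count _ [] = 0
count N (N ∷ w) = suc (count N w)
count N (E ∷ w) = count N w
count E (E ∷ w) = suc (count E w)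
count E (N ∷ w) = count E w

IsL : ℕ → List Step → Set
IsL n w = count N w ≡ n × count E w ≡ n

IsB : ℕ → List Step → Set
IsB n w = length w ≡ n + n × ((k : ℕ) → count E (take k w) ≤ count N (take k w))

nextLabel : ℕ → ℤ → Step → ℤ
nextLabel n ℓ N = ℓ ℤ.+ + (suc (n + n))
nextLabel n ℓ E = ℓ - + (n + n)

-- walk over s_i (i ≥ 2), carrying ℓ_i and s_{i-1}
sweepEntries : ℕ → ℤ → Step → List Step → List (Step × ℤ)
sweepEntries n ℓ p [] = []
sweepEntries n ℓ p (s ∷ w) with ℓ <? + 0 | + 0 <? ℓ
... | yes _ | _     = (s , ℓ) ∷ sweepEntries n (nextLabel n ℓ s) s w
... | no _  | yes _ = (p , - ℓ) ∷ sweepEntries n (nextLabel n ℓ s) s w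
... | no _  | no _  = sweepEntries n (nextLabel n ℓ s) s w

lastStep : Step → List Step → Step
lastStep s [] = s
lastStep _ (t ∷ w) = lastStep t w

sweepX : ℕ → List Step → List (Step × ℤ)
sweepX n [] = []
sweepX n (s ∷ w) = (lastStep s w , - (+ n)) ∷ sweepEntries n (nextLabel n (+ 0) s) s w

insertL : Step × ℤ → List (Step × ℤ) → List (Step × ℤ)
insertL x [] = x ∷ []
insertL x (y ∷ ys) with proj₂ x ≤? proj₂ y
... | yes _ = x ∷ y ∷ ys
... | no _  = y ∷ insertL x ys

sortL : List (Step × ℤ) → List (Step × ℤ)
sortL [] = []
sortL (x ∷ xs) = insertL x (sortL xs)

sw : ℕ → List Step → List Step
sw n w = map proj₁ (sortL (sweepX n w))

lambdasFrom : ℕ → List Step → List ℕ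
lambdasFrom e [] = []
lambdasFrom e (N ∷ w) = e ∷ lambdasFrom e w
lambdasFrom e (E ∷ w) = lambdasFrom (suc e) w

lambdas : List Step → List ℕ
lambdas = lambdasFrom 0

-- μ_i = (n+1-i) - λ_{n+1-i}: list (k - λ_k)_{k=1..n} reversed
mu : List Step → List ℤ
mu w = reverse (zipWith (λ k l → + suc k - + l) (upTo (length (lambdas w))) (lambdas w))

letterPlus : ℕ → ℤ → List Step
letterPlus j x with x ℤ.≟ + j | x ℤ.≟ + suc j
... | yes _ | _     = N ∷ []
... | no _  | yes _ = E ∷ []
... | no _  | no _  = []

letterMinus : ℕ → ℤ → List Step
letterMinus j x with x ℤ.≟ - (+ j) | x ℤ.≟ - (+ suc j)
... | yes _ | _     = N ∷ []
... | no _  | yes _ = E ∷ []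
... | no _  | no _  = []

SPlusFwd : ℕ → List ℤ → List Step
SPlusFwd j a = concatMap (letterPlus j) a

SMinusBwd : ℕ → List ℤ → List Step
SMinusBwd j a = concatMap (letterMinus j) (reverse a)

zetaC : ℕ → List Step → List Step
zetaC n π = concatMap (λ j → SMinusBwd j (mu π) ++ SPlusFwd j (mu π)) (downFrom (suc n))

{-# OPTIONS --safe #-}

-- A point of π at height d = #N − #E has label 2nd + #N, so the sweep reads the heights from the outside
-- in: height −j forward by outgoing steps, height j backward by incoming steps. Every excursion beyond a
-- given height starts and ends with opposite steps and nothing is read during it, so these letters can be
-- recovered from the north steps alone, which gives ζ_C.
-- Cut π at its diagonal points into excursions, each the contour word of an ordered tree (lower excursions
-- being read backwards). Read from right to left, the swept word first lists the excursions (N below,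
-- E above the diagonal) and then spells, as N E^d, the number d of children of each node in breadth-first
-- order. The number of lower excursions is half the final height of the swept word, and a forest is
-- determined by its breadth-first degree sequence, which can be any sequence satisfying the ballot
-- condition; hence sw is a bijection onto the ballot words.
module Submission where

open import Defs
open import Data.Empty using (⊥-elim)
open import Data.Integer as ℤ using (ℤ; +_; -[1+_]; -_; _⊖_)
import Data.Integer.Properties as ℤₚ
open import Algebra.Properties.AbelianGroup ℤₚ.+-0-abelianGroup using (∙-cancelʳ)
open import Data.Integer.Tactic.RingSolver using (solve-∀)
open import Data.List using (List; []; _∷_; _++_; map; length; reverse; concat; concatMap; filter; zipWith;
  replicate; take; drop; applyUpTo; upTo; downFrom; initLast; _∷ʳ′_)
import Data.List.Properties as Listₚ
open import Data.List.Relation.Binary.Permutation.Propositional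
  using (_↭_; prep; swap; ↭-refl; ↭-reflexive; ↭-sym; ↭-trans; module PermutationReasoning)
import Data.List.Relation.Binary.Permutation.Propositional.Properties as Perm
open import Data.List.Relation.Unary.All as All using (All; []; _∷_)
import Data.List.Relation.Unary.All.Properties as Allₚ
open import Data.List.Relation.Unary.AllPairs using (AllPairs; []; _∷_)
import Data.List.Relation.Unary.AllPairs.Properties as AllPairsₚ
open import Data.List.Relation.Unary.Any using (here; there)
open import Data.Nat using (ℕ; zero; suc; _+_; _*_; _∸_; _≤_; _<_; z≤n; s≤s)
import Data.Nat.Properties as ℕₚ
open import Data.Product using (Σ-syntax; ∃; _×_; _,_; proj₁; proj₂)
open import Data.Sum using (_⊎_; inj₁; inj₂) renaming (swap to swap⊎)
open import Function using (flip; _∘_)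
open import Relation.Binary.PropositionalEquality
open import Relation.Nullary using (yes; no; ¬_)
open import Relation.Unary using (Decidable)

-- Sorting

-- The label 2n(a - b) + a of a point with a north and b east steps behind it orders points by
-- height first and, since a ≤ n < 2n, by a within one height. Negating the label of a point at
-- height j ≥ 0 puts it among the points at height -(j+1): there a point below the diagonal has
-- offset a < n, and a negated one has offset 2n - a ≥ n, which dictates the shape of `blockWord`.
-- The substitute label -n is minus the label of the end point (n, n), so X runs over all points of
-- the path except the origin, and no label occurs twice. Both sw and ζ_C are compared with
-- `blockWords`, and bijectivity becomes a statement about `blockWords` alone. Pairing height -(j+1)
-- with height j staggers the two sides of the diagonal by one. Read from the right, however, the
-- word passes through lower roots, upper roots, lower children, upper children and so on, which is
-- a single breadth-first traversal of the lower trees followed by the upper ones.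

_≼_ _≺_ : Step × ℤ → Step × ℤ → Set
x ≼ y = proj₂ x ℤ.≤ proj₂ y
x ≺ y = proj₂ x ℤ.< proj₂ y

insertL-↭ : ∀ x ys → insertL x ys ↭ x ∷ ys
insertL-↭ x [] = ↭-refl
insertL-↭ x (y ∷ ys) with proj₂ x ℤ.≤? proj₂ y
... | yes _ = ↭-refl
... | no _  = ↭-trans (prep y (insertL-↭ x ys)) (swap y x ↭-refl)

sortL-↭ : ∀ xs → sortL xs ↭ xs
sortL-↭ [] = ↭-refl
sortL-↭ (x ∷ xs) = ↭-trans (insertL-↭ x (sortL xs)) (prep x (sortL-↭ xs))

insertL-sorted : ∀ x {ys} → AllPairs _≼_ ys → AllPairs _≼_ (insertL x ys)
insertL-sorted x [] = [] ∷ []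
insertL-sorted x {y ∷ ys} (y≼ys ∷ ys↗) with proj₂ x ℤ.≤? proj₂ y
... | yes x≼y = (x≼y ∷ All.map (ℤₚ.≤-trans x≼y) y≼ys) ∷ y≼ys ∷ ys↗
... | no x⋠y  = Perm.All-resp-↭ (↭-sym (insertL-↭ x ys)) (ℤₚ.<⇒≤ (ℤₚ.≰⇒> x⋠y) ∷ y≼ys) ∷ insertL-sorted x ys↗

sortL-sorted : ∀ xs → AllPairs _≼_ (sortL xs)
sortL-sorted [] = []
sortL-sorted (x ∷ xs) = insertL-sorted x (sortL-sorted xs)

-- Strictness on one side is enough: if the heads differ, each lies in the tail of the other list,
-- so x ≤ y and y < x. Hence the way in which insertion breaks ties never matters.
sorted-unique : ∀ {xs ys} → AllPairs _≼_ xs → AllPairs _≺_ ys → xs ↭ ys → xs ≡ ys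
sorted-unique {[]} _ _ xs↭ys = sym (Perm.↭-empty-inv (↭-sym xs↭ys))
sorted-unique {x ∷ xs} {[]} _ _ xs↭ys = ⊥-elim (Perm.¬x∷xs↭[] xs↭ys)
sorted-unique {x ∷ xs} {y ∷ ys} (x≼xs ∷ xs↗) (y≺ys ∷ ys↗) xs↭ys
  with Perm.∈-resp-↭ xs↭ys (here refl) | Perm.∈-resp-↭ (↭-sym xs↭ys) (here refl)
... | here refl | _         = cong (x ∷_) (sorted-unique xs↗ ys↗ (Perm.drop-∷ xs↭ys))
... | there _   | here refl = cong (x ∷_) (sorted-unique xs↗ ys↗ (Perm.drop-∷ xs↭ys))
... | there x∈ys | there y∈xs =
  ⊥-elim (ℤₚ.<⇒≱ (All.lookup y≺ys x∈ys) (All.lookup x≼xs y∈xs))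

sortL-unique : ∀ {xs ys} → AllPairs _≺_ ys → xs ↭ ys → sortL xs ≡ ys
sortL-unique {xs} ys↗ xs↭ys = sorted-unique (sortL-sorted xs) ys↗ (↭-trans (sortL-↭ xs) xs↭ys)

module _ {A : Set} where

  concatMap-++-↭ : ∀ {B : Set} (f g : B → List A) bs →
    concatMap (λ b → f b ++ g b) bs ↭ concatMap f bs ++ concatMap g bs
  concatMap-++-↭ f g [] = ↭-refl
  concatMap-++-↭ f g (b ∷ bs) = begin
    (f b ++ g b) ++ concatMap (λ b → f b ++ g b) bs       ↭⟨ Perm.++⁺ˡ _ (concatMap-++-↭ f g bs) ⟩
    (f b ++ g b) ++ concatMap f bs ++ concatMap g bs      ↭⟨ Perm.++-assoc (f b) _ _ ⟩
    f b ++ g b ++ concatMap f bs ++ concatMap g bs        ↭⟨ Perm.++⁺ˡ (f b) (Perm.shifts (g b) (concatMap f bs)) ⟩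
    f b ++ concatMap f bs ++ g b ++ concatMap g bs        ↭⟨ Perm.++-assoc (f b) _ _ ⟨
    (f b ++ concatMap f bs) ++ g b ++ concatMap g bs      ∎
    where open PermutationReasoning

  concatMap-cong-↭ : ∀ {B : Set} {f g : B → List A} → (∀ b → f b ↭ g b) → ∀ bs → concatMap f bs ↭ concatMap g bs
  concatMap-cong-↭ f↭g [] = ↭-refl
  concatMap-cong-↭ f↭g (b ∷ bs) = Perm.++⁺ (f↭g b) (concatMap-cong-↭ f↭g bs)

  filter-⊎-↭ : {P Q R : A → Set} (P? : Decidable P) (Q? : Decidable Q) (R? : Decidable R) →
    (∀ {x} → R x → P x ⊎ Q x) → (∀ {x} → P x → R x) → (∀ {x} → Q x → R x) → (∀ {x} → P x → ¬ Q x) →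
    ∀ xs → filter P? xs ++ filter Q? xs ↭ filter R? xs
  filter-⊎-↭ P? Q? R? split inP inQ disjoint [] = ↭-refl
  filter-⊎-↭ P? Q? R? split inP inQ disjoint (x ∷ xs)
    with P? x | Q? x | R? x | filter-⊎-↭ P? Q? R? split inP inQ disjoint xs
  ... | yes p | yes q | _     | _  = ⊥-elim (disjoint p q)
  ... | yes _ | no _  | yes _ | ih = prep x ih
  ... | yes p | no _  | no ¬r | _  = ⊥-elim (¬r (inP p))
  ... | no _  | yes _ | yes _ | ih = ↭-trans (Perm.shift x (filter P? xs) _) (prep x ih)
  ... | no _  | yes q | no ¬r | _  = ⊥-elim (¬r (inQ q))
  ... | no _  | no _  | no _  | ih = ih
  ... | no ¬p | no ¬q | yes r | _  with split r
  ...   | inj₁ p = ⊥-elim (¬p p)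
  ...   | inj₂ q = ⊥-elim (¬q q)

  module _ (key : A → ℕ) where

    bucket : List A → ℕ → List A
    bucket xs j = filter (λ x → key x ℕₚ.≟ j) xs

    buckets-below-↭ : ∀ m xs → concatMap (bucket xs) (downFrom m) ↭ filter (λ x → key x ℕₚ.<? m) xs
    buckets-below-↭ zero xs = ↭-reflexive (sym (Listₚ.filter-none _ (All.universal (λ _ ()) xs)))
    buckets-below-↭ (suc m) xs = ↭-trans (Perm.++⁺ˡ (bucket xs m) (buckets-below-↭ m xs))
      (filter-⊎-↭ _ _ _
        (λ x<1+m → swap⊎ (ℕₚ.m≤n⇒m<n∨m≡n (ℕₚ.≤-pred x<1+m)))
        (λ x≡m → s≤s (ℕₚ.≤-reflexive x≡m))
        ℕₚ.m<n⇒m<1+n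
        (λ x≡m → ℕₚ.<-irrefl x≡m)
        xs)

    buckets-↭ : ∀ m {xs} → All (λ x → key x < m) xs → concatMap (bucket xs) (downFrom m) ↭ xs
    buckets-↭ m {xs} xs<m = ↭-trans (buckets-below-↭ m xs) (↭-reflexive (Listₚ.filter-all _ xs<m))

-- Labels of lattice points

⊖-∸ : ∀ m n o → (m ⊖ n) ℤ.- + o ≡ m ⊖ (n + o)
⊖-∸ m n o = begin
  (m ⊖ n) ℤ.- + o            ≡⟨ cong (ℤ._- + o) (ℤₚ.m-n≡m⊖n m n) ⟨
  (+ m ℤ.- + n) ℤ.- + o      ≡⟨ ℤₚ.+-assoc (+ m) (- + n) (- + o) ⟩
  + m ℤ.+ (- + n ℤ.- + o)    ≡⟨ cong (ℤ._+_ (+ m)) (ℤₚ.neg-distrib-+ (+ n) (+ o)) ⟨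
  + m ℤ.- + (n + o)          ≡⟨ ℤₚ.m-n≡m⊖n m (n + o) ⟩
  m ⊖ (n + o)                ∎
  where open ≡-Reasoning

m<n⇒m⊖n<0 : ∀ {m n} → m < n → m ⊖ n ℤ.< + 0
m<n⇒m⊖n<0 {m} {n} m<n = subst (m ⊖ n ℤ.<_) (ℤₚ.n⊖n≡0 n) (ℤₚ.⊖-monoˡ-< n m<n)

0<larger : ∀ {a b} → b ≤ a → 0 < a + b → 0 < a
0<larger {zero} z≤n 0<0 = 0<0
0<larger {suc _} _ _ = s≤s z≤n

-- (s , j , a) stands for a step s at a lattice point preceded by a north steps, at height j if the point is
-- weakly above the diagonal and at height −(j + 1) if it is below. This shift puts the labels of level j
-- into the interval [−2n(j+1), −2nj).
Entry : Set
Entry = Step × ℕ × ℕ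

level : Entry → ℕ
level (_ , j , _) = j

module _ (n : ℕ) where

  private M = n + n

  label : ℕ → ℕ → ℤ
  label a b = (a * suc M) ⊖ (b * M)

  -- Both are written as an offset above -2n(j+1), so that within one level comparing labels means
  -- comparing offsets. The low offset grows with a, the upper one falls, which is why upper points
  -- come out backwards.
  lowLabel upLabel : Entry → Step × ℤ
  lowLabel (s , j , a) = s , a ⊖ (suc j * M)
  upLabel  (s , j , a) = s , (M ∸ a) ⊖ (suc j * M)

  label-N : ∀ a b → nextLabel n (label a b) N ≡ label (suc a) b
  label-N a b = trans (ℤₚ.distribˡ-⊖-+-pos (suc M) (a * suc M) (b * M))
                      (cong (_⊖ (b * M)) (ℕₚ.+-comm (a * suc M) (suc M)))

  label-E : ∀ a b → nextLabel n (label a b) E ≡ label a (suc b)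
  label-E a b = trans (⊖-∸ (a * suc M) (b * M) M)
                      (cong ((a * suc M) ⊖_) (ℕₚ.+-comm (b * M) M))

  label-low : ∀ a j → label a (a + suc j) ≡ a ⊖ (suc j * M)
  label-low a j = begin
    (a * suc M) ⊖ ((a + suc j) * M)            ≡⟨ cong₂ _⊖_ (trans (ℕₚ.*-suc a M) (ℕₚ.+-comm a (a * M))) (ℕₚ.*-distribʳ-+ M a (suc j)) ⟩
    (a * M + a) ⊖ (a * M + suc j * M)          ≡⟨ ℤₚ.+-cancelˡ-⊖ (a * M) a (suc j * M) ⟩
    a ⊖ (suc j * M)                            ∎
    where open ≡-Reasoning

  label-up : ∀ b j → b + j ≤ M → - label (b + j) b ≡ (M ∸ (b + j)) ⊖ (suc j * M)
  label-up b j a≤M = begin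
    - label a b                                  ≡⟨ ℤₚ.⊖-swap (b * M) (a * suc M) ⟨
    (b * M) ⊖ (a * suc M)                        ≡⟨ cong₂ _⊖_ (sym (ℕₚ.+-identityʳ (b * M))) expand ⟩
    (b * M + 0) ⊖ (b * M + (a + j * M))          ≡⟨ ℤₚ.+-cancelˡ-⊖ (b * M) 0 (a + j * M) ⟩
    0 ⊖ (a + j * M)                              ≡⟨ ℤₚ.+-cancelˡ-⊖ (M ∸ a) 0 (a + j * M) ⟨
    (M ∸ a + 0) ⊖ (M ∸ a + (a + j * M))          ≡⟨ cong₂ _⊖_ (ℕₚ.+-identityʳ (M ∸ a)) contract ⟩
    (M ∸ a) ⊖ (M + j * M)                        ∎
    where
    open ≡-Reasoning
    a = b + j
    expand : a * suc M ≡ b * M + (a + j * M)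
    expand = begin
      a * suc M              ≡⟨ ℕₚ.*-suc a M ⟩
      a + a * M              ≡⟨ cong (_+_ a) (ℕₚ.*-distribʳ-+ M b j) ⟩
      a + (b * M + j * M)    ≡⟨ ℕₚ.+-assoc a (b * M) (j * M) ⟨
      a + b * M + j * M      ≡⟨ cong (_+ j * M) (ℕₚ.+-comm a (b * M)) ⟩
      b * M + a + j * M      ≡⟨ ℕₚ.+-assoc (b * M) a (j * M) ⟩
      b * M + (a + j * M)    ∎
    contract : M ∸ a + (a + j * M) ≡ M + j * M
    contract = trans (sym (ℕₚ.+-assoc (M ∸ a) a (j * M))) (cong (_+ j * M) (ℕₚ.m∸n+n≡m a≤M))

valley peak : Step → ℕ → ℕ → List Entry
valley s a b with a ℕₚ.<? b
... | yes _ = (s , b ∸ suc a , a) ∷ []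
... | no _  = []
peak s a b with a ℕₚ.<? b
... | yes _ = []
... | no _  = (s , a ∸ b , a) ∷ []

-- The path w starts at the point with a north and b east steps behind it, which is entered by p; low
-- records outgoing steps and up incoming ones.
low : ℕ → ℕ → List Step → List Entry
low a b [] = []
low a b (N ∷ w) = valley N a b ++ low (suc a) b w
low a b (E ∷ w) = valley E a b ++ low a (suc b) w

up : Step → ℕ → ℕ → List Step → List Entry
up p a b [] = peak p a b
up p a b (N ∷ w) = peak p a b ++ up N (suc a) b w
up p a b (E ∷ w) = peak p a b ++ up E a (suc b) w

sweepEntries-neg : ∀ n {ℓ} p s w → ℓ ℤ.< + 0 →
  sweepEntries n ℓ p (s ∷ w) ≡ (s , ℓ) ∷ sweepEntries n (nextLabel n ℓ s) s w
sweepEntries-neg n {ℓ} p s w ℓ<0 with ℓ ℤ.<? + 0 | + 0 ℤ.<? ℓ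
... | yes _ | _ = refl
... | no ℓ≮0 | _ = ⊥-elim (ℓ≮0 ℓ<0)

sweepEntries-pos : ∀ n {ℓ} p s w → + 0 ℤ.< ℓ →
  sweepEntries n ℓ p (s ∷ w) ≡ (p , - ℓ) ∷ sweepEntries n (nextLabel n ℓ s) s w
sweepEntries-pos n {ℓ} p s w 0<ℓ with ℓ ℤ.<? + 0 | + 0 ℤ.<? ℓ
... | yes ℓ<0 | _      = ⊥-elim (ℤₚ.<-asym ℓ<0 0<ℓ)
... | no _    | yes _  = refl
... | no _    | no 0≮ℓ = ⊥-elim (0≮ℓ 0<ℓ)

module _ (n : ℕ) (1≤n : 1 ≤ n) where

  private
    M = n + n
    n<M : n < M
    n<M = ℕₚ.+-monoˡ-≤ n 1≤n

    below : ∀ {a b} j → a + suc j ≡ b → a ≤ n → (label n a b ℤ.< + 0) × (label n a b ≡ a ⊖ (suc j * M))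
    below {a} j refl a≤n = subst (ℤ._< + 0) (sym (label-low n a j)) (m<n⇒m⊖n<0 (ℕₚ.<-≤-trans (ℕₚ.≤-<-trans a≤n n<M) (ℕₚ.m≤m+n M (j * M))))
      , label-low n a j

    above : ∀ {a b} j → b + j ≡ a → 1 ≤ a → a ≤ n → (+ 0 ℤ.< label n a b) × (- label n a b ≡ (M ∸ a) ⊖ (suc j * M))
    above {a} {b} j refl 1≤a a≤n =
      ℤₚ.neg-cancel-< (subst (ℤ._< + 0) (sym eq) (m<n⇒m⊖n<0 (ℕₚ.<-≤-trans (ℕₚ.∸-monoʳ-< 1≤a a≤M) (ℕₚ.m≤m+n M (j * M))))) , eq
      where
      a≤M = ℕₚ.≤-trans a≤n (ℕₚ.<⇒≤ n<M)
      eq = label-up n b j a≤M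

  -- The extra entry `- label n n n` equals -n, the substitute label of the first step. It belongs
  -- to the end point, which `up` records last and for which `sweepEntries` produces nothing.
  Split : ℕ → ℕ → Step → List Step → Set
  Split a b p w = (lastStep p w , - label n n n) ∷ sweepEntries n (label n a b) p w
                  ↭ map (lowLabel n) (low a b w) ++ map (upLabel n) (up p a b w)

  private
    split-step : ∀ a b p s {ℓ} w {L U} → a ≤ n → 0 < a + b → nextLabel n (label n a b) s ≡ ℓ →
      (lastStep s w , - label n n n) ∷ sweepEntries n ℓ s w ↭ map (lowLabel n) L ++ map (upLabel n) U →
      (lastStep s w , - label n n n) ∷ sweepEntries n (label n a b) p (s ∷ w)
        ↭ map (lowLabel n) (valley s a b ++ L) ++ map (upLabel n) (peak p a b ++ U)
    split-step a b p s w {L} a≤n 0<a+b refl ih with a ℕₚ.<? b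
    ... | yes a<b = ↭-trans
      (↭-reflexive (cong ((lastStep s w , - label n n n) ∷_) (trans (sweepEntries-neg n p s w (proj₁ here′)) (cong (λ ℓ → (s , ℓ) ∷ rest) (proj₂ here′)))))
      (↭-trans (swap _ _ ↭-refl) (prep _ ih))
      where
      rest = sweepEntries n (nextLabel n (label n a b) s) s w
      here′ = below (b ∸ suc a) (trans (ℕₚ.+-suc a _) (ℕₚ.m+[n∸m]≡n a<b)) a≤n
    ... | no a≮b = ↭-trans
      (↭-reflexive (cong ((lastStep s w , - label n n n) ∷_) (trans (sweepEntries-pos n p s w (proj₁ here′)) (cong (λ ℓ → (p , ℓ) ∷ rest) (proj₂ here′)))))
      (↭-trans (swap _ _ ↭-refl) (↭-trans (prep _ ih) (↭-sym (Perm.shift _ (map (lowLabel n) L) _))))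
      where
      rest = sweepEntries n (nextLabel n (label n a b) s) s w
      b≤a = ℕₚ.≮⇒≥ a≮b
      here′ = above (a ∸ b) (ℕₚ.m+[n∸m]≡n b≤a) (0<larger b≤a 0<a+b) a≤n

  -- The condition 0 < a + b keeps away from the origin. Any other point with b ≤ a has a ≥ 1 and so
  -- a positive label; therefore the silent branch of `sweepEntries` for label 0 is never taken.
  sweepEntries-↭ : ∀ a b p w → a + count N w ≡ n → b + count E w ≡ n → 0 < a + b → Split a b p w
  sweepEntries-↭ a b p [] a≡n b≡n 0<a+b rewrite ℕₚ.+-identityʳ a | ℕₚ.+-identityʳ b | a≡n | b≡n
    with n ℕₚ.<? n
  ... | yes n<n = ⊥-elim (ℕₚ.<-irrefl refl n<n)
  ... | no _    = ↭-reflexive (cong (λ ℓ → (p , ℓ) ∷ []) (proj₂ (above (n ∸ n) (ℕₚ.m+[n∸m]≡n {n} ℕₚ.≤-refl) 1≤n ℕₚ.≤-refl)))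
  sweepEntries-↭ a b p (N ∷ w) a≡n b≡n 0<a+b = split-step a b p N w (ℕₚ.m+n≤o⇒m≤o a (ℕₚ.≤-reflexive a≡n)) 0<a+b (label-N n a b)
    (sweepEntries-↭ (suc a) b N w (trans (sym (ℕₚ.+-suc a _)) a≡n) b≡n (s≤s z≤n))
  sweepEntries-↭ a b p (E ∷ w) a≡n b≡n 0<a+b = split-step a b p E w (ℕₚ.m+n≤o⇒m≤o a (ℕₚ.≤-reflexive a≡n)) 0<a+b (label-E n a b)
    (sweepEntries-↭ a (suc b) E w a≡n (trans (sym (ℕₚ.+-suc b _)) b≡n) (ℕₚ.<-≤-trans (s≤s z≤n) (ℕₚ.≤-reflexive (sym (ℕₚ.+-suc a b)))))

-- Order of the entries within a level

north : Entry → ℕ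
north (_ , _ , a) = a

NorthIncreasing : Entry → Entry → Set
NorthIncreasing x y = level x ≡ level y → north x < north y

-- Here c is a lower bound for the number of steps taken. The last component is c ≤ a + b with b = a
-- + j + 1 or b = a - j, freed of subtraction.
LowBound UpBound : ℕ → ℕ → Entry → Set
LowBound n c (_ , j , a) = j ≤ n × a < n × c ≤ a + (a + suc j)
UpBound  n c (_ , j , a) = j ≤ n × (1 ≤ a × a ≤ n) × c + j ≤ a + a

LowBound-weaken : ∀ {n c} {xs : List Entry} → All (LowBound n (suc c)) xs → All (LowBound n c) xs
LowBound-weaken = All.map λ (j≤n , a<n , c<) → j≤n , a<n , ℕₚ.<⇒≤ c<

UpBound-weaken : ∀ {n c} {xs : List Entry} → All (UpBound n (suc c)) xs → All (UpBound n c) xs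
UpBound-weaken = All.map λ (j≤n , a≤n , c<) → j≤n , a≤n , ℕₚ.<⇒≤ c<

half-< : ∀ {a b} → a + a < b + b → a < b
half-< {a} {b} 2a<2b = ℕₚ.≰⇒> λ b≤a → ℕₚ.<⇒≱ 2a<2b (ℕₚ.+-mono-≤ b≤a b≤a)

-- A low point of level j lies a + b = 2a + j + 1 steps along the path, so a later point of the same
-- level has a larger a. For `up` the same argument uses a + b = 2a - j.
low-sorted : ∀ n a b w → b + count E w ≡ n → All (LowBound n (a + b)) (low a b w) × AllPairs NorthIncreasing (low a b w)
low-sorted n a b [] _ = [] , []
low-sorted n a b (s ∷ w) b≡n with low-step s b≡n
  where
  low-step : ∀ s → b + count E (s ∷ w) ≡ n →
    Σ[ L ∈ List Entry ] low a b (s ∷ w) ≡ valley s a b ++ L × All (LowBound n (suc (a + b))) L × AllPairs NorthIncreasing L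
  low-step N b≡n = _ , refl , low-sorted n (suc a) b w b≡n
  low-step E b≡n = _ , refl , subst (λ c → All (LowBound n c) (low a (suc b) w)) (ℕₚ.+-suc a b) (proj₁ ih) , proj₂ ih
    where ih = low-sorted n a (suc b) w (trans (sym (ℕₚ.+-suc b _)) b≡n)
... | L , eq , bounds , incr rewrite eq with a ℕₚ.<? b
... | no _    = LowBound-weaken bounds , incr
... | yes a<b =
  (ℕₚ.≤-trans (ℕₚ.m∸n≤m b (suc a)) b≤n , ℕₚ.<-≤-trans a<b b≤n , ℕₚ.≤-reflexive sum) ∷ LowBound-weaken bounds ,
  All.map (λ {y} → below {y}) bounds ∷ incr
  where
  b≤n = ℕₚ.m+n≤o⇒m≤o b (ℕₚ.≤-reflexive b≡n)
  j = b ∸ suc a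
  sum : a + b ≡ a + (a + suc j)
  sum = cong (_+_ a) (sym (trans (ℕₚ.+-suc a j) (ℕₚ.m+[n∸m]≡n a<b)))
  below : ∀ {y} → LowBound n (suc (a + b)) y → NorthIncreasing (s , j , a) y
  below {_ , _ , a′} (_ , _ , c<) refl = half-< (ℕₚ.+-cancelʳ-< (suc j) (a + a) (a′ + a′)
    (subst₂ _<_ (trans sum (sym (ℕₚ.+-assoc a a (suc j)))) (sym (ℕₚ.+-assoc a′ a′ (suc j))) c<))

up-sorted : ∀ n p a b w → 0 < a + b → a + count N w ≡ n → All (UpBound n (a + b)) (up p a b w) × AllPairs NorthIncreasing (up p a b w)
up-sorted n p a b w 0<a+b a≡n with up-step w a≡n
  where
  up-step : ∀ w → a + count N w ≡ n →
    Σ[ U ∈ List Entry ] up p a b w ≡ peak p a b ++ U × All (UpBound n (suc (a + b))) U × AllPairs NorthIncreasing U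
  up-step [] a≡n = [] , sym (Listₚ.++-identityʳ _) , [] , []
  up-step (N ∷ w) a≡n = _ , refl , up-sorted n N (suc a) b w (s≤s z≤n) (trans (sym (ℕₚ.+-suc a _)) a≡n)
  up-step (E ∷ w) a≡n = _ , refl , subst (λ c → All (UpBound n c) (up E a (suc b) w)) (ℕₚ.+-suc a b) (proj₁ ih) , proj₂ ih
    where ih = up-sorted n E a (suc b) w (ℕₚ.<-≤-trans (s≤s z≤n) (ℕₚ.m≤n+m (suc b) a)) a≡n
... | U , eq , bounds , incr rewrite eq with a ℕₚ.<? b
... | yes _  = UpBound-weaken bounds , incr
... | no a≮b =
  (ℕₚ.≤-trans (ℕₚ.m∸n≤m a b) a≤n , (0<larger b≤a 0<a+b , a≤n) , ℕₚ.≤-reflexive sum) ∷ UpBound-weaken bounds ,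
  All.map (λ {y} → above {y}) bounds ∷ incr
  where
  b≤a = ℕₚ.≮⇒≥ a≮b
  a≤n = ℕₚ.m+n≤o⇒m≤o a (ℕₚ.≤-reflexive a≡n)
  j = a ∸ b
  sum : a + b + j ≡ a + a
  sum = trans (ℕₚ.+-assoc a b j) (cong (_+_ a) (ℕₚ.m+[n∸m]≡n b≤a))
  above : ∀ {y} → UpBound n (suc (a + b)) y → NorthIncreasing (p , j , a) y
  above {_ , _ , a′} (_ , _ , c<) refl = half-< (subst (λ c → suc c ≤ a′ + a′) sum c<)

module _ {A : Set} where

  allPairs-map-with-All : {P : A → Set} {R S : A → A → Set} → (∀ {x y} → P x → P y → R x y → S x y) →
    ∀ {xs} → All P xs → AllPairs R xs → AllPairs S xs
  allPairs-map-with-All f [] [] = []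
  allPairs-map-with-All f (px ∷ pxs) (rx ∷ rxs) =
    All.zipWith (λ (py , r) → f px py r) (pxs , rx) ∷ allPairs-map-with-All f pxs rxs

  allPairs-reverse : {R : A → A → Set} → ∀ {xs} → AllPairs R xs → AllPairs (flip R) (reverse xs)
  allPairs-reverse [] = []
  allPairs-reverse {R} {x ∷ xs} (rx ∷ rxs) = subst (AllPairs (flip R)) (sym (Listₚ.unfold-reverse x xs))
    (AllPairsₚ.++⁺ (allPairs-reverse rxs) ([] ∷ [])
      (All.map (λ r → r ∷ []) (Perm.All-resp-↭ (↭-sym (Perm.↭-reverse xs)) rx)))

-- The sorted list of entries, block by block

module _ (n : ℕ) (1≤n : 1 ≤ n) where

  private M = n + n

  InBlock : ℕ → Step × ℤ → Set
  InBlock j x = (0 ⊖ (suc j * M) ℤ.≤ proj₂ x) × (proj₂ x ℤ.< 0 ⊖ (j * M))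

  module _ (L U : List Entry) where

    block : ℕ → List (Step × ℤ)
    block j = map (lowLabel n) (bucket level L j) ++ map (upLabel n) (reverse (bucket level U j))

    blocks : List (Step × ℤ)
    blocks = concatMap block (downFrom (suc n))

    blocks-↭ : All (λ x → level x < suc n) L → All (λ x → level x < suc n) U →
      map (lowLabel n) L ++ map (upLabel n) U ↭ blocks
    blocks-↭ L<n U<n = ↭-sym (begin
      blocks
        ↭⟨ concatMap-++-↭ (map (lowLabel n) ∘ bucket level L) (map (upLabel n) ∘ reverse ∘ bucket level U) js ⟩
      concatMap (map (lowLabel n) ∘ bucket level L) js ++ concatMap (map (upLabel n) ∘ reverse ∘ bucket level U) js
        ↭⟨ Perm.++⁺ˡ (concatMap (map (lowLabel n) ∘ bucket level L) js)
             (concatMap-cong-↭ (λ j → Perm.map⁺ (upLabel n) (Perm.↭-reverse (bucket level U j))) js) ⟩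
      concatMap (map (lowLabel n) ∘ bucket level L) js ++ concatMap (map (upLabel n) ∘ bucket level U) js
        ≡⟨ cong₂ _++_ (Listₚ.map-concatMap (lowLabel n) (bucket level L) js) (Listₚ.map-concatMap (upLabel n) (bucket level U) js) ⟨
      map (lowLabel n) (concatMap (bucket level L) js) ++ map (upLabel n) (concatMap (bucket level U) js)
        ↭⟨ Perm.++⁺ (Perm.map⁺ (lowLabel n) (buckets-↭ level (suc n) L<n)) (Perm.map⁺ (upLabel n) (buckets-↭ level (suc n) U<n)) ⟩
      map (lowLabel n) L ++ map (upLabel n) U ∎)
      where
      open PermutationReasoning
      js = downFrom (suc n)

    module _ {c d} (boundL : All (LowBound n c) L) (incrL : AllPairs NorthIncreasing L)
             (boundU : All (UpBound n d) U) (incrU : AllPairs NorthIncreasing U) where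

      module _ (j : ℕ) where

        private
          LowIn UpIn : Entry → Set
          LowIn x = level x ≡ j × north x < n
          UpIn x = level x ≡ j × (1 ≤ north x × north x ≤ n)

          allL : All LowIn (bucket level L j)
          allL = All.zip (Allₚ.all-filter _ L , Allₚ.filter⁺ _ (All.map (λ b → proj₁ (proj₂ b)) boundL))
          allU : All UpIn (reverse (bucket level U j))
          allU = Perm.All-resp-↭ (↭-sym (Perm.↭-reverse (bucket level U j)))
            (All.zip (Allₚ.all-filter _ U , Allₚ.filter⁺ _ (All.map (λ b → proj₁ (proj₂ b)) boundU)))

          inBlock : ∀ {o} → o < M → (0 ⊖ (suc j * M) ℤ.≤ o ⊖ (suc j * M)) × (o ⊖ (suc j * M) ℤ.< 0 ⊖ (j * M))
          inBlock {o} o<M = ℤₚ.⊖-monoˡ-≤ (suc j * M) z≤n ,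
            ℤₚ.<-≤-trans (ℤₚ.⊖-monoˡ-< (suc j * M) o<M)
              (ℤₚ.≤-reflexive (trans (cong (_⊖ (M + j * M)) (sym (ℕₚ.+-identityʳ M))) (ℤₚ.+-cancelˡ-⊖ M 0 (j * M))))

        block-bounds : All (InBlock j) (block j)
        block-bounds = Allₚ.++⁺
          (Allₚ.map⁺ (All.map (λ { (refl , a<n) → inBlock (ℕₚ.<-≤-trans a<n (ℕₚ.m≤m+n n n)) }) allL))
          (Allₚ.map⁺ (All.map (λ { (refl , 1≤a , a≤n) → inBlock (ℕₚ.∸-monoʳ-< 1≤a (ℕₚ.≤-trans a≤n (ℕₚ.m≤m+n n n))) }) allU))

        block-sorted : AllPairs _≺_ (block j)
        block-sorted = AllPairsₚ.++⁺
          (AllPairsₚ.map⁺ (allPairs-map-with-All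
            (λ { (refl , _) (refl , _) a<a′ → ℤₚ.⊖-monoˡ-< (suc j * M) (a<a′ refl) })
            allL (AllPairsₚ.filter⁺ _ incrL)))
          (AllPairsₚ.map⁺ (allPairs-map-with-All
            (λ { (refl , _ , a≤n) (refl , _) a′<a → ℤₚ.⊖-monoˡ-< (suc j * M)
                   (ℕₚ.∸-monoʳ-< (a′<a refl) (ℕₚ.≤-trans a≤n (ℕₚ.m≤m+n n n))) })
            allU (allPairs-reverse (AllPairsₚ.filter⁺ _ incrU))))
          -- Low offsets stay below n, upper offsets M - a′ do not since a′ ≤ n; so the low half of
          -- the block precedes the upper half.
          (Allₚ.map⁺ (All.map (λ { (refl , a<n) → Allₚ.map⁺ (All.map (λ { (refl , _ , a′≤n) →
              ℤₚ.⊖-monoˡ-< (suc j * M) (ℕₚ.<-≤-trans a<n (ℕₚ.m+n≤o⇒m≤o∸n n (ℕₚ.+-monoʳ-≤ n a′≤n))) }) allU) }) allL))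

      blocks-above : ∀ k → All (λ x → 0 ⊖ (k * M) ℤ.≤ proj₂ x) (concatMap block (downFrom k))
      blocks-above zero = []
      blocks-above (suc k) = Allₚ.++⁺ (All.map proj₁ (block-bounds k))
        (All.map (ℤₚ.≤-trans (ℤₚ.⊖-monoʳ-≥-≤ 0 (ℕₚ.m≤n+m (k * M) M))) (blocks-above k))

      blocks-sorted : ∀ k → AllPairs _≺_ (concatMap block (downFrom k))
      blocks-sorted zero = []
      blocks-sorted (suc k) = AllPairsₚ.++⁺ (block-sorted k) (blocks-sorted k)
        (All.map (λ (_ , x<) → All.map (ℤₚ.<-≤-trans x<) (blocks-above k)) (block-bounds k))

-- Steps leaving or entering a fixed height

onLine : ℤ → Step → List Step
onLine (+ 0) s = s ∷ []
onLine _     s = []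

-- outSteps t w: the steps of w leaving points with #E − #N = t (counted from the start of w);
-- inSteps t w: the steps entering points with #N − #E = t.
outSteps inSteps : ℤ → List Step → List Step
outSteps t [] = []
outSteps t (N ∷ w) = onLine t N ++ outSteps (ℤ.suc t) w
outSteps t (E ∷ w) = onLine t E ++ outSteps (ℤ.pred t) w
inSteps t [] = []
inSteps t (N ∷ w) = onLine (ℤ.pred t) N ++ inSteps (ℤ.pred t) w
inSteps t (E ∷ w) = onLine (ℤ.suc t) E ++ inSteps (ℤ.suc t) w

-- The target line is measured from the current point, so every step shifts it. `rise` is the target
-- left after w in the convention of `inSteps`, `fall` in that of `outSteps`.
rise fall : ℤ → List Step → ℤ
fall t [] = t
fall t (N ∷ w) = fall (ℤ.suc t) w
fall t (E ∷ w) = fall (ℤ.pred t) w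
rise t [] = t
rise t (N ∷ w) = rise (ℤ.pred t) w
rise t (E ∷ w) = rise (ℤ.suc t) w

outSteps-++ : ∀ t u v → outSteps t (u ++ v) ≡ outSteps t u ++ outSteps (fall t u) v
outSteps-++ t [] v = refl
outSteps-++ t (N ∷ u) v = trans (cong (onLine t N ++_) (outSteps-++ _ u v)) (sym (Listₚ.++-assoc (onLine t N) _ _))
outSteps-++ t (E ∷ u) v = trans (cong (onLine t E ++_) (outSteps-++ _ u v)) (sym (Listₚ.++-assoc (onLine t E) _ _))

inSteps-++ : ∀ t u v → inSteps t (u ++ v) ≡ inSteps t u ++ inSteps (rise t u) v
inSteps-++ t [] v = refl
inSteps-++ t (N ∷ u) v = trans (cong (onLine _ N ++_) (inSteps-++ _ u v)) (sym (Listₚ.++-assoc (onLine (ℤ.pred t) N) _ _))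
inSteps-++ t (E ∷ u) v = trans (cong (onLine _ E ++_) (inSteps-++ _ u v)) (sym (Listₚ.++-assoc (onLine (ℤ.suc t) E) _ _))

fall-++ : ∀ t u v → fall t (u ++ v) ≡ fall (fall t u) v
fall-++ t [] v = refl
fall-++ t (N ∷ u) v = fall-++ _ u v
fall-++ t (E ∷ u) v = fall-++ _ u v

fall-reverse : ∀ t w → fall (rise t w) (reverse w) ≡ t
fall-reverse t [] = refl
fall-reverse t (N ∷ w) rewrite Listₚ.unfold-reverse N w | fall-++ (rise (ℤ.pred t) w) (reverse w) (N ∷ [])
  | fall-reverse (ℤ.pred t) w = ℤₚ.suc-pred t
fall-reverse t (E ∷ w) rewrite Listₚ.unfold-reverse E w | fall-++ (rise (ℤ.suc t) w) (reverse w) (E ∷ [])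
  | fall-reverse (ℤ.suc t) w = ℤₚ.pred-suc t

onLine-reverse : ∀ t s → reverse (onLine t s) ≡ onLine t s
onLine-reverse (+ 0) s = refl
onLine-reverse (+ suc _) s = refl
onLine-reverse -[1+ _ ] s = refl

-- A step that enters a point leaves it when the word is read backwards, and heights counted from
-- the other end change sign. This is why `inSteps` measures N minus E but `outSteps` E minus N.
inSteps-reverse : ∀ t w → reverse (inSteps t w) ≡ outSteps (rise t w) (reverse w)
inSteps-reverse t [] = refl
inSteps-reverse t (N ∷ w)
  rewrite Listₚ.reverse-++ (onLine (ℤ.pred t) N) (inSteps (ℤ.pred t) w) | Listₚ.unfold-reverse N w
  | outSteps-++ (rise (ℤ.pred t) w) (reverse w) (N ∷ []) | fall-reverse (ℤ.pred t) w
  | inSteps-reverse (ℤ.pred t) w | onLine-reverse (ℤ.pred t) N | Listₚ.++-identityʳ (onLine (ℤ.pred t) N) = refl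
inSteps-reverse t (E ∷ w)
  rewrite Listₚ.reverse-++ (onLine (ℤ.suc t) E) (inSteps (ℤ.suc t) w) | Listₚ.unfold-reverse E w
  | outSteps-++ (rise (ℤ.suc t) w) (reverse w) (E ∷ []) | fall-reverse (ℤ.suc t) w
  | inSteps-reverse (ℤ.suc t) w | onLine-reverse (ℤ.suc t) E | Listₚ.++-identityʳ (onLine (ℤ.suc t) E) = refl

rise-count : ∀ t w → rise t w ℤ.+ + count N w ≡ t ℤ.+ + count E w
rise-count t [] = refl
rise-count t (N ∷ w) = begin
  rise (ℤ.pred t) w ℤ.+ + suc (count N w)        ≡⟨ suc-right (rise (ℤ.pred t) w) (count N w) ⟩
  ℤ.suc (rise (ℤ.pred t) w ℤ.+ + count N w)      ≡⟨ cong ℤ.suc (rise-count (ℤ.pred t) w) ⟩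
  ℤ.suc (ℤ.pred t ℤ.+ + count E w)               ≡⟨ ℤₚ.+-assoc (ℤ.1ℤ) (ℤ.pred t) (+ count E w) ⟨
  ℤ.suc (ℤ.pred t) ℤ.+ + count E w               ≡⟨ cong (ℤ._+ + count E w) (ℤₚ.suc-pred t) ⟩
  t ℤ.+ + count E w                              ∎
  where
  open ≡-Reasoning
  suc-right : ∀ i k → i ℤ.+ + suc k ≡ ℤ.suc (i ℤ.+ + k)
  suc-right i k = trans (ℤₚ.+-comm i (+ suc k)) (trans (ℤₚ.+-assoc (ℤ.1ℤ) (+ k) i) (cong ℤ.suc (ℤₚ.+-comm (+ k) i)))
rise-count t (E ∷ w) = begin
  rise (ℤ.suc t) w ℤ.+ + count N w     ≡⟨ rise-count (ℤ.suc t) w ⟩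
  ℤ.suc t ℤ.+ + count E w              ≡⟨ cong (ℤ._+ + count E w) (ℤₚ.+-comm ℤ.1ℤ t) ⟩
  t ℤ.+ ℤ.1ℤ ℤ.+ + count E w           ≡⟨ ℤₚ.+-assoc t ℤ.1ℤ (+ count E w) ⟩
  t ℤ.+ + suc (count E w)              ∎
  where open ≡-Reasoning

Balanced : List Step → Set
Balanced w = count N w ≡ count E w

rise-balanced : ∀ t w → Balanced w → rise t w ≡ t
rise-balanced t w bal = ∙-cancelʳ (+ count E w) _ _
  (subst (λ k → rise t w ℤ.+ + k ≡ t ℤ.+ + count E w) bal (rise-count t w))

count-++ : ∀ s u v → count s (u ++ v) ≡ count s u + count s v
count-++ _ [] v = refl
count-++ N (N ∷ u) v = cong suc (count-++ N u v)
count-++ N (E ∷ u) v = count-++ N u v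
count-++ E (N ∷ u) v = count-++ E u v
count-++ E (E ∷ u) v = cong suc (count-++ E u v)

count-reverse : ∀ s w → count s (reverse w) ≡ count s w
count-reverse _ [] = refl
count-reverse s (x ∷ w) = begin
  count s (reverse (x ∷ w))               ≡⟨ cong (count s) (Listₚ.unfold-reverse x w) ⟩
  count s (reverse w ++ x ∷ [])           ≡⟨ count-++ s (reverse w) (x ∷ []) ⟩
  count s (reverse w) + count s (x ∷ [])  ≡⟨ cong (_+ count s (x ∷ [])) (count-reverse s w) ⟩
  count s w + count s (x ∷ [])            ≡⟨ ℕₚ.+-comm (count s w) _ ⟩
  count s (x ∷ []) + count s w            ≡⟨ count-++ s (x ∷ []) w ⟨
  count s (x ∷ w)                         ∎
  where open ≡-Reasoning

reverse-balanced : ∀ w → Balanced w → Balanced (reverse w)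
reverse-balanced w bal = trans (count-reverse N w) (trans bal (sym (count-reverse E w)))

inSteps-reverse-balanced : ∀ t w → Balanced w → reverse (inSteps t w) ≡ outSteps t (reverse w)
inSteps-reverse-balanced t w bal = trans (inSteps-reverse t w) (cong (λ t → outSteps t (reverse w)) (rise-balanced t w bal))

fall-balanced : ∀ t w → Balanced w → fall t w ≡ t
fall-balanced t w bal = begin
  fall t w                                         ≡⟨ cong₂ fall (rise-balanced t (reverse w) (reverse-balanced w bal)) (Listₚ.reverse-involutive w) ⟨
  fall (rise t (reverse w)) (reverse (reverse w))  ≡⟨ fall-reverse t (reverse w) ⟩
  t                                                ∎
  where open ≡-Reasoning

-- The normal form for both sides of the equation. For balanced π the second half reads the points
-- of π at height j backwards, by the steps that enter them in π.
blockWord : List Step → ℕ → List Step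
blockWord π j = outSteps (+ suc j) π ++ outSteps (+ j) (reverse π)

blockWords : ℕ → List Step → List Step
blockWords n π = concatMap (blockWord π) (downFrom (suc n))

onLine-≢ : ∀ a b s → a ≢ b → onLine (a ⊖ b) s ≡ []
onLine-≢ a b s a≢b with a ⊖ b in eq
... | + suc _ = refl
... | -[1+ _ ] = refl
... | + 0 = ⊥-elim (a≢b (ℤₚ.+-injective (ℤₚ.i-j≡0⇒i≡j (+ a) (+ b) (trans (ℤₚ.m-n≡m⊖n a b) eq))))

onLine-≡ : ∀ a b s → a ≡ b → onLine (a ⊖ b) s ≡ s ∷ []
onLine-≡ a _ s refl rewrite ℤₚ.n⊖n≡0 a = refl

suc-⊖ : ∀ a b → ℤ.suc (a ⊖ b) ≡ suc a ⊖ b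
suc-⊖ a b = ℤₚ.distribʳ-⊖-+-pos 1 a b

pred-⊖ : ∀ a b → ℤ.pred (a ⊖ b) ≡ a ⊖ suc b
pred-⊖ a b = ℤₚ.distribʳ-⊖-+-neg 0 a b

lettersAt : ℕ → List Entry → List Step
lettersAt j xs = map proj₁ (bucket level xs j)

lettersAt-++ : ∀ j xs ys → lettersAt j (xs ++ ys) ≡ lettersAt j xs ++ lettersAt j ys
lettersAt-++ j xs ys = trans (cong (map proj₁) (Listₚ.filter-++ _ xs ys)) (Listₚ.map-++ proj₁ (bucket level xs j) _)

lettersAt-[] : ∀ j s k a → k ≢ j → lettersAt j ((s , k , a) ∷ []) ≡ []
lettersAt-[] j s k a k≢j = cong (map proj₁) (Listₚ.filter-reject (λ x → level x ℕₚ.≟ j) k≢j)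

lettersAt-[x] : ∀ j s k a → k ≡ j → lettersAt j ((s , k , a) ∷ []) ≡ s ∷ []
lettersAt-[x] j s k a k≡j = cong (map proj₁) (Listₚ.filter-accept (λ x → level x ℕₚ.≟ j) k≡j)

lettersAt-valley : ∀ j s a b → lettersAt j (valley s a b) ≡ onLine ((a + suc j) ⊖ b) s
lettersAt-valley j s a b with a ℕₚ.<? b
... | no a≮b  = sym (onLine-≢ (a + suc j) b s λ { refl → a≮b (ℕₚ.m<m+n a (s≤s z≤n)) })
... | yes a<b with b ∸ suc a ℕₚ.≟ j
...   | yes refl = trans (lettersAt-[x] j s (b ∸ suc a) a refl) (sym (onLine-≡ (a + suc j) b s (trans (ℕₚ.+-suc a _) (ℕₚ.m+[n∸m]≡n a<b))))
...   | no  b≢j  = trans (lettersAt-[] j s (b ∸ suc a) a b≢j) (sym (onLine-≢ (a + suc j) b s λ { refl → b≢j (trans (cong (_∸ suc a) (ℕₚ.+-suc a j)) (ℕₚ.m+n∸m≡n (suc a) j)) }))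

lettersAt-peak : ∀ j s a b → lettersAt j (peak s a b) ≡ onLine ((b + j) ⊖ a) s
lettersAt-peak j s a b with a ℕₚ.<? b
... | yes a<b = sym (onLine-≢ (b + j) a s λ { refl → ℕₚ.<⇒≱ a<b (ℕₚ.m≤m+n b j) })
... | no a≮b with a ∸ b ℕₚ.≟ j
...   | yes refl = trans (lettersAt-[x] j s (a ∸ b) a refl) (sym (onLine-≡ (b + j) a s (ℕₚ.m+[n∸m]≡n (ℕₚ.≮⇒≥ a≮b))))
...   | no  a≢j  = trans (lettersAt-[] j s (a ∸ b) a a≢j) (sym (onLine-≢ (b + j) a s λ { refl → a≢j (ℕₚ.m+n∸m≡n b j) }))

lettersAt-low : ∀ j a b w → lettersAt j (low a b w) ≡ outSteps ((a + suc j) ⊖ b) w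
lettersAt-low j a b [] = refl
lettersAt-low j a b (N ∷ w) = trans (lettersAt-++ j (valley N a b) _)
  (cong₂ _++_ (lettersAt-valley j N a b)
    (trans (lettersAt-low j (suc a) b w) (cong (λ t → outSteps t w) (sym (suc-⊖ (a + suc j) b)))))
lettersAt-low j a b (E ∷ w) = trans (lettersAt-++ j (valley E a b) _)
  (cong₂ _++_ (lettersAt-valley j E a b)
    (trans (lettersAt-low j a (suc b) w) (cong (λ t → outSteps t w) (sym (pred-⊖ (a + suc j) b)))))

-- `up` records a point one step later than `inSteps` does, together with the step p that led there;
-- hence the separate letter for p.
lettersAt-up : ∀ j p a b w → lettersAt j (up p a b w) ≡ onLine ((b + j) ⊖ a) p ++ inSteps ((b + j) ⊖ a) w
lettersAt-up j p a b [] = trans (lettersAt-peak j p a b) (sym (Listₚ.++-identityʳ _))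
lettersAt-up j p a b (N ∷ w) = trans (lettersAt-++ j (peak p a b) _)
  (cong₂ _++_ (lettersAt-peak j p a b)
    (trans (lettersAt-up j N (suc a) b w) (cong (λ t → onLine t N ++ inSteps t w) (sym (pred-⊖ (b + j) a)))))
lettersAt-up j p a b (E ∷ w) = trans (lettersAt-++ j (peak p a b) _)
  (cong₂ _++_ (lettersAt-peak j p a b)
    (trans (lettersAt-up j E a (suc b) w) (cong (λ t → onLine t E ++ inSteps t w) (sym (suc-⊖ (b + j) a)))))

label-end : ∀ n → label n n n ≡ + n
label-end n = begin
  (n * suc (n + n)) ⊖ (n * (n + n))              ≡⟨ cong₂ _⊖_ (trans (ℕₚ.*-suc n (n + n)) (ℕₚ.+-comm n _)) (sym (ℕₚ.+-identityʳ (n * (n + n)))) ⟩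
  (n * (n + n) + n) ⊖ (n * (n + n) + 0)          ≡⟨ ℤₚ.+-cancelˡ-⊖ (n * (n + n)) n 0 ⟩
  + n                                            ∎
  where open ≡-Reasoning

module _ (n : ℕ) (1≤n : 1 ≤ n) where

  map-proj₁-blocks : ∀ π L U → Balanced π → (∀ j → lettersAt j L ≡ outSteps (+ suc j) π) →
    (∀ j → lettersAt j U ≡ inSteps (+ j) π) → map proj₁ (blocks n 1≤n L U) ≡ blockWords n π
  map-proj₁-blocks π L U bal lowL upU = trans (Listₚ.map-concatMap proj₁ (block n 1≤n L U) js)
    (Listₚ.concatMap-cong each js)
    where
    open ≡-Reasoning
    js = downFrom (suc n)
    each : ∀ j → map proj₁ (block n 1≤n L U j) ≡ blockWord π j
    each j = begin
      map proj₁ (map (lowLabel n) (bucket level L j) ++ map (upLabel n) (reverse (bucket level U j)))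
        ≡⟨ Listₚ.map-++ proj₁ (map (lowLabel n) (bucket level L j)) _ ⟩
      map proj₁ (map (lowLabel n) (bucket level L j)) ++ map proj₁ (map (upLabel n) (reverse (bucket level U j)))
        ≡⟨ cong₂ _++_ (Listₚ.map-∘ (bucket level L j)) (Listₚ.map-∘ (reverse (bucket level U j))) ⟨
      lettersAt j L ++ map proj₁ (reverse (bucket level U j))
        ≡⟨ cong (lettersAt j L ++_) (Listₚ.reverse-map proj₁ (bucket level U j)) ⟩
      lettersAt j L ++ reverse (lettersAt j U)
        ≡⟨ cong₂ (λ u v → u ++ reverse v) (lowL j) (upU j) ⟩
      outSteps (+ suc j) π ++ reverse (inSteps (+ j) π)
        ≡⟨ cong (outSteps (+ suc j) π ++_) (inSteps-reverse-balanced (+ j) π bal) ⟩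
      blockWord π j
        ∎

  sortL-blocks : ∀ a b p w → 0 < a + b → a + count N w ≡ n → b + count E w ≡ n →
    sortL ((lastStep p w , - (+ n)) ∷ sweepEntries n (label n a b) p w) ≡ blocks n 1≤n (low a b w) (up p a b w)
  sortL-blocks a b p w 0<a+b a≡n b≡n = sortL-unique
    (blocks-sorted n 1≤n _ _ (proj₁ lows) (proj₂ lows) (proj₁ ups) (proj₂ ups) (suc n))
    (↭-trans
      (↭-reflexive (cong (λ ℓ → (lastStep p w , - ℓ) ∷ sweepEntries n (label n a b) p w) (sym (label-end n))))
      (↭-trans (sweepEntries-↭ n 1≤n a b p w a≡n b≡n 0<a+b)
        (blocks-↭ n 1≤n _ _ (All.map (λ b → s≤s (proj₁ b)) (proj₁ lows)) (All.map (λ b → s≤s (proj₁ b)) (proj₁ ups)))))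
    where
    lows = low-sorted n a b w b≡n
    ups = up-sorted n p a b w 0<a+b a≡n

  sw-blockWords : ∀ π → IsL n π → sw n π ≡ blockWords n π
  sw-blockWords [] (0≡n , _) = ⊥-elim (ℕₚ.<⇒≢ 1≤n 0≡n)
  sw-blockWords (N ∷ w) (a≡n , b≡n) = begin
    map proj₁ (sortL (sweepX n (N ∷ w)))
      ≡⟨ cong (λ ℓ → map proj₁ (sortL ((lastStep N w , - (+ n)) ∷ sweepEntries n ℓ N w))) (label-N n 0 0) ⟩
    map proj₁ (sortL ((lastStep N w , - (+ n)) ∷ sweepEntries n (label n 1 0) N w))
      ≡⟨ cong (map proj₁) (sortL-blocks 1 0 N w (s≤s z≤n) a≡n b≡n) ⟩
    map proj₁ (blocks n 1≤n (low 1 0 w) (up N 1 0 w))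
      -- Splitting off the first step loses no letter: it leaves height 0, which
      -- `outSteps (+ suc j)` does not read, and its arrival is recorded through the argument N of
      -- `up`. Both agreements hold by computation.
      ≡⟨ map-proj₁-blocks (N ∷ w) (low 1 0 w) (up N 1 0 w) (trans a≡n (sym b≡n)) (λ j → lettersAt-low j 1 0 w) (λ j → lettersAt-up j N 1 0 w) ⟩
    blockWords n (N ∷ w)
      ∎
    where open ≡-Reasoning
  sw-blockWords (E ∷ w) (a≡n , b≡n) = begin
    map proj₁ (sortL (sweepX n (E ∷ w)))
      ≡⟨ cong (λ ℓ → map proj₁ (sortL ((lastStep E w , - (+ n)) ∷ sweepEntries n ℓ E w))) (label-E n 0 0) ⟩
    map proj₁ (sortL ((lastStep E w , - (+ n)) ∷ sweepEntries n (label n 0 1) E w))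
      ≡⟨ cong (map proj₁) (sortL-blocks 0 1 E w (s≤s z≤n) a≡n b≡n) ⟩
    map proj₁ (blocks n 1≤n (low 0 1 w) (up E 0 1 w))
      ≡⟨ map-proj₁-blocks (E ∷ w) (low 0 1 w) (up E 0 1 w) (trans a≡n (sym b≡n)) (λ j → lettersAt-low j 0 1 w) (λ j → lettersAt-up j E 0 1 w) ⟩
    blockWords n (E ∷ w)
      ∎
    where open ≡-Reasoning

-- North letters and the words of ζ_C

northLetter : ℤ → List Step
northLetter (+ 0)     = N ∷ []
northLetter -[1+ 0 ]  = E ∷ []
northLetter _         = []

-- A common form of the words S⁺ and S⁻. With the target convention of `outSteps`, t = 0 means that
-- the north step starts on the line and t = -1 that it ends there.
northLetters : ℤ → List Step → List Step
northLetters t [] = []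
northLetters t (N ∷ w) = northLetter t ++ northLetters (ℤ.suc t) w
northLetters t (E ∷ w) = northLetters (ℤ.pred t) w

-- An excursion across the target level is recorded by outSteps when it starts and by northLetters when
-- it returns, so northLetters still owes one E while the excursion lasts.
owed : ℤ → List Step
owed (+ _)     = []
owed -[1+ _ ]  = E ∷ []

-- The debt changes only between t = 0 and t = -1: `outSteps` writes E on the way down,
-- `northLetters` on the way back. A nonnegative end value ensures that no such excursion stays
-- open, so every E is paid.
northLetters-outSteps : ∀ t w {k} → fall t w ≡ + k → northLetters t w ≡ owed t ++ outSteps t w
northLetters-outSteps (+ _) [] _ = refl
northLetters-outSteps (+ 0) (N ∷ w) end = cong (N ∷_) (northLetters-outSteps (+ 1) w end)
northLetters-outSteps (+ suc m) (N ∷ w) end = northLetters-outSteps (+ suc (suc m)) w end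
northLetters-outSteps -[1+ 0 ] (N ∷ w) end = cong (E ∷_) (northLetters-outSteps (+ 0) w end)
northLetters-outSteps -[1+ suc m ] (N ∷ w) end = northLetters-outSteps -[1+ m ] w end
northLetters-outSteps (+ 0) (E ∷ w) end = northLetters-outSteps -[1+ 0 ] w end
northLetters-outSteps (+ suc m) (E ∷ w) end = northLetters-outSteps (+ m) w end
northLetters-outSteps -[1+ m ] (E ∷ w) end = northLetters-outSteps -[1+ suc m ] w end

northLetter-[] : ∀ t → t ≢ + 0 → t ≢ -[1+ 0 ] → northLetter t ≡ []
northLetter-[] (+ 0) t≢0 _ = ⊥-elim (t≢0 refl)
northLetter-[] (+ suc _) _ _ = refl
northLetter-[] -[1+ 0 ] _ t≢-1 = ⊥-elim (t≢-1 refl)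
northLetter-[] -[1+ suc _ ] _ _ = refl

letterPlus-northLetter : ∀ j x → letterPlus j x ≡ northLetter (+ j ℤ.- x)
letterPlus-northLetter j x with x ℤ.≟ + j | x ℤ.≟ + suc j
... | yes refl | _ = cong northLetter (sym (ℤₚ.+-inverseʳ (+ j)))
... | no _ | yes refl = cong northLetter (sym (identity (+ j)))
  where
  identity : ∀ i → i ℤ.- (ℤ.1ℤ ℤ.+ i) ≡ -[1+ 0 ]
  identity = solve-∀
... | no x≢j | no x≢1+j = sym (northLetter-[] (+ j ℤ.- x)
    (λ j-x≡0 → x≢j (sym (ℤₚ.i-j≡0⇒i≡j (+ j) x j-x≡0)))
    (λ j-x≡-1 → x≢1+j (trans (identity (+ j) x) (trans (cong (λ t → + j ℤ.- t) j-x≡-1) (ℤₚ.+-comm (+ j) ℤ.1ℤ)))))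
  where
  identity : ∀ i x → x ≡ i ℤ.- (i ℤ.- x)
  identity = solve-∀

letterMinus-northLetter : ∀ j x → letterMinus j x ≡ northLetter (+ j ℤ.+ x)
letterMinus-northLetter j x with x ℤ.≟ - (+ j) | x ℤ.≟ - (+ suc j)
... | yes refl | _ = cong northLetter (sym (ℤₚ.+-inverseʳ (+ j)))
... | no _ | yes refl = cong northLetter (sym (identity (+ j)))
  where
  identity : ∀ i → i ℤ.- (ℤ.1ℤ ℤ.+ i) ≡ -[1+ 0 ]
  identity = solve-∀
... | no x≢-j | no x≢-1-j = sym (northLetter-[] (+ j ℤ.+ x)
    (λ j+x≡0 → x≢-j (trans (identity (+ j) x) (trans (cong (ℤ._- (+ j)) j+x≡0) (ℤₚ.+-identityˡ _))))
    (λ j+x≡-1 → x≢-1-j (trans (identity (+ j) x) (trans (cong (ℤ._- (+ j)) j+x≡-1) (sym (ℤₚ.neg-distrib-+ ℤ.1ℤ (+ j)))))))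
  where
  identity : ∀ i x → x ≡ (i ℤ.+ x) ℤ.- i
  identity = solve-∀

-- For `heightsBeforeN` the word is a path traversed backwards, so N lowers the height; what comes
-- before N there comes after it in the original path.
heightsAfterN heightsBeforeN : ℤ → List Step → List ℤ
heightsAfterN d [] = []
heightsAfterN d (N ∷ w) = ℤ.suc d ∷ heightsAfterN (ℤ.suc d) w
heightsAfterN d (E ∷ w) = heightsAfterN (ℤ.pred d) w
heightsBeforeN d [] = []
heightsBeforeN d (N ∷ w) = d ∷ heightsBeforeN (ℤ.pred d) w
heightsBeforeN d (E ∷ w) = heightsBeforeN (ℤ.suc d) w

heightsBeforeN-++ : ∀ d u v → heightsBeforeN d (u ++ v) ≡ heightsBeforeN d u ++ heightsBeforeN (rise d u) v
heightsBeforeN-++ d [] v = refl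
heightsBeforeN-++ d (N ∷ u) v = cong (d ∷_) (heightsBeforeN-++ (ℤ.pred d) u v)
heightsBeforeN-++ d (E ∷ u) v = heightsBeforeN-++ (ℤ.suc d) u v

rise-++ : ∀ t u v → rise t (u ++ v) ≡ rise (rise t u) v
rise-++ t [] v = refl
rise-++ t (N ∷ u) v = rise-++ _ u v
rise-++ t (E ∷ u) v = rise-++ _ u v

rise-reverse : ∀ t w → rise (fall t w) (reverse w) ≡ t
rise-reverse t [] = refl
rise-reverse t (N ∷ w) rewrite Listₚ.unfold-reverse N w | rise-++ (fall (ℤ.suc t) w) (reverse w) (N ∷ [])
  | rise-reverse (ℤ.suc t) w = ℤₚ.pred-suc t
rise-reverse t (E ∷ w) rewrite Listₚ.unfold-reverse E w | rise-++ (fall (ℤ.pred t) w) (reverse w) (E ∷ [])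
  | rise-reverse (ℤ.pred t) w = ℤₚ.suc-pred t

heightsAfterN-reverse : ∀ d w → reverse (heightsAfterN d w) ≡ heightsBeforeN (fall d w) (reverse w)
heightsAfterN-reverse d [] = refl
heightsAfterN-reverse d (N ∷ w)
  rewrite Listₚ.unfold-reverse (ℤ.suc d) (heightsAfterN (ℤ.suc d) w) | Listₚ.unfold-reverse N w
  | heightsBeforeN-++ (fall (ℤ.suc d) w) (reverse w) (N ∷ [])
  | rise-reverse (ℤ.suc d) w | heightsAfterN-reverse (ℤ.suc d) w = refl
heightsAfterN-reverse d (E ∷ w)
  rewrite Listₚ.unfold-reverse E w | heightsBeforeN-++ (fall (ℤ.pred d) w) (reverse w) (E ∷ [])
  | heightsAfterN-reverse (ℤ.pred d) w = sym (Listₚ.++-identityʳ _)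

-- The number k - λ_k counts norths minus easts just after the k-th north step, so it is the height
-- there. The function f absorbs the index shift caused by the recursion.
zipWith-lambdas : ∀ (f : ℕ → ℕ) k e w → (∀ i → f i ≡ k + i) →
  zipWith (λ k l → + suc k ℤ.- + l) (applyUpTo f (length (lambdasFrom e w))) (lambdasFrom e w) ≡ heightsAfterN (k ⊖ e) w
zipWith-lambdas f k e [] _ = refl
zipWith-lambdas f k e (N ∷ w) f≗k+ = cong₂ _∷_
  (trans (cong (λ k → + suc k ℤ.- + e) (trans (f≗k+ 0) (ℕₚ.+-identityʳ k))) (trans (ℤₚ.m-n≡m⊖n (suc k) e) (sym (suc-⊖ k e))))
  (trans (zipWith-lambdas (f ∘ suc) (suc k) e w (λ i → trans (f≗k+ (suc i)) (ℕₚ.+-suc k i)))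
    (cong (λ d → heightsAfterN d w) (sym (suc-⊖ k e))))
zipWith-lambdas f k e (E ∷ w) f≗k+ = trans (zipWith-lambdas f k (suc e) w f≗k+) (cong (λ d → heightsAfterN d w) (sym (pred-⊖ k e)))

mu-heights : ∀ w → mu w ≡ reverse (heightsAfterN (+ 0) w)
mu-heights w = cong reverse (zipWith-lambdas (λ i → i) 0 0 w (λ _ → refl))

letterPlus-heightsBeforeN : ∀ j d w → concatMap (letterPlus j) (heightsBeforeN d w) ≡ northLetters (+ j ℤ.- d) w
letterPlus-heightsBeforeN j d [] = refl
letterPlus-heightsBeforeN j d (N ∷ w) = cong₂ _++_ (letterPlus-northLetter j d)
  (trans (letterPlus-heightsBeforeN j (ℤ.pred d) w) (cong (λ t → northLetters t w) (identity (+ j) d)))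
  where
  identity : ∀ i x → i ℤ.- (ℤ.-1ℤ ℤ.+ x) ≡ ℤ.1ℤ ℤ.+ (i ℤ.- x)
  identity = solve-∀
letterPlus-heightsBeforeN j d (E ∷ w) =
  trans (letterPlus-heightsBeforeN j (ℤ.suc d) w) (cong (λ t → northLetters t w) (identity (+ j) d))
  where
  identity : ∀ i x → i ℤ.- (ℤ.1ℤ ℤ.+ x) ≡ ℤ.-1ℤ ℤ.+ (i ℤ.- x)
  identity = solve-∀

-- Heights are recorded at the end of a north step, while `northLetters` looks at its start. A step
-- ending at -j starts at -(j+1), whence the shift to `suc j`.
letterMinus-heightsAfterN : ∀ j d w → concatMap (letterMinus j) (heightsAfterN d w) ≡ northLetters (+ suc j ℤ.+ d) w
letterMinus-heightsAfterN j d [] = refl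
letterMinus-heightsAfterN j d (N ∷ w) = cong₂ _++_
  (trans (letterMinus-northLetter j (ℤ.suc d)) (cong northLetter (identity₁ (+ j) d)))
  (trans (letterMinus-heightsAfterN j (ℤ.suc d) w) (cong (λ t → northLetters t w) (identity₂ (+ suc j) d)))
  where
  identity₁ : ∀ i x → i ℤ.+ (ℤ.1ℤ ℤ.+ x) ≡ (ℤ.1ℤ ℤ.+ i) ℤ.+ x
  identity₁ = solve-∀
  identity₂ : ∀ i x → i ℤ.+ (ℤ.1ℤ ℤ.+ x) ≡ ℤ.1ℤ ℤ.+ (i ℤ.+ x)
  identity₂ = solve-∀
letterMinus-heightsAfterN j d (E ∷ w) =
  trans (letterMinus-heightsAfterN j (ℤ.pred d) w) (cong (λ t → northLetters t w) (identity (+ suc j) d))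
  where
  identity : ∀ i x → i ℤ.+ (ℤ.-1ℤ ℤ.+ x) ≡ ℤ.-1ℤ ℤ.+ (i ℤ.+ x)
  identity = solve-∀

SMinusBwd-outSteps : ∀ j w → Balanced w → SMinusBwd j (mu w) ≡ outSteps (+ suc j) w
SMinusBwd-outSteps j w bal = begin
  concatMap (letterMinus j) (reverse (mu w))
    ≡⟨ cong (concatMap (letterMinus j)) (trans (cong reverse (mu-heights w)) (Listₚ.reverse-involutive (heightsAfterN (+ 0) w))) ⟩
  concatMap (letterMinus j) (heightsAfterN (+ 0) w)
    ≡⟨ letterMinus-heightsAfterN j (+ 0) w ⟩
  northLetters (+ suc j ℤ.+ + 0) w
    ≡⟨ cong (λ t → northLetters t w) (ℤₚ.+-identityʳ (+ suc j)) ⟩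
  northLetters (+ suc j) w
    ≡⟨ northLetters-outSteps (+ suc j) w (fall-balanced (+ suc j) w bal) ⟩
  outSteps (+ suc j) w
    ∎
  where open ≡-Reasoning

SPlusFwd-outSteps : ∀ j w → Balanced w → SPlusFwd j (mu w) ≡ outSteps (+ j) (reverse w)
SPlusFwd-outSteps j w bal = begin
  concatMap (letterPlus j) (mu w)
    ≡⟨ cong (concatMap (letterPlus j)) (trans (mu-heights w) (heightsAfterN-reverse (+ 0) w)) ⟩
  concatMap (letterPlus j) (heightsBeforeN (fall (+ 0) w) (reverse w))
    ≡⟨ cong (λ d → concatMap (letterPlus j) (heightsBeforeN d (reverse w))) (fall-balanced (+ 0) w bal) ⟩
  concatMap (letterPlus j) (heightsBeforeN (+ 0) (reverse w))
    ≡⟨ letterPlus-heightsBeforeN j (+ 0) (reverse w) ⟩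
  northLetters (+ j ℤ.+ + 0) (reverse w)
    ≡⟨ cong (λ t → northLetters t (reverse w)) (ℤₚ.+-identityʳ (+ j)) ⟩
  northLetters (+ j) (reverse w)
    ≡⟨ northLetters-outSteps (+ j) (reverse w) (fall-balanced (+ j) (reverse w) (reverse-balanced w bal)) ⟩
  outSteps (+ j) (reverse w)
    ∎
  where open ≡-Reasoning

zetaC-blockWords : ∀ n w → Balanced w → zetaC n w ≡ blockWords n w
zetaC-blockWords n w bal = Listₚ.concatMap-cong
  (λ j → cong₂ _++_ (SMinusBwd-outSteps j w bal) (SPlusFwd-outSteps j w bal)) (downFrom (suc n))

-- Trees and their contour words

data Tree : Set where
  node : List Tree → Tree

children : Tree → List Tree
children (node cs) = cs

degree : Tree → ℕ
degree t = length (children t)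

size : List Tree → ℕ
size [] = 0
size (node cs ∷ ts) = suc (size cs + size ts)

size-++ : ∀ ss ts → size (ss ++ ts) ≡ size ss + size ts
size-++ [] ts = refl
size-++ (node cs ∷ ss) ts = cong suc (trans (cong (_+_ (size cs)) (size-++ ss ts)) (sym (ℕₚ.+-assoc (size cs) _ _)))

size-children : ∀ ts → size ts ≡ length ts + size (concatMap children ts)
size-children [] = refl
size-children (node cs ∷ ts) = cong suc (begin
  size cs + size ts                                        ≡⟨ cong (_+_ (size cs)) (size-children ts) ⟩
  size cs + (length ts + size (concatMap children ts))     ≡⟨ ℕₚ.+-assoc (size cs) _ _ ⟨
  size cs + length ts + size (concatMap children ts)       ≡⟨ cong (_+ size (concatMap children ts)) (ℕₚ.+-comm (size cs) _) ⟩
  length ts + size cs + size (concatMap children ts)       ≡⟨ ℕₚ.+-assoc (length ts) _ _ ⟩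
  length ts + (size cs + size (concatMap children ts))     ≡⟨ cong (_+_ (length ts)) (size-++ cs _) ⟨
  length ts + size (cs ++ concatMap children ts)           ∎)
  where open ≡-Reasoning

-- The first list is the queue of the traversal. A relation avoids recursion on a queue that does
-- not shrink structurally, and it can be read in both directions.
data BFS : List Tree → List ℕ → Set where
  done : BFS [] []
  step : ∀ {cs ts ds} → BFS (ts ++ cs) ds → BFS (node cs ∷ ts) (length cs ∷ ds)

BFS-functional : ∀ {ts ds ds′} → BFS ts ds → BFS ts ds′ → ds ≡ ds′
BFS-functional done done = refl
BFS-functional (step p) (step q) = cong (_ ∷_) (BFS-functional p q)

++-injective-length : ∀ {A : Set} (xs xs′ : List A) {ys ys′} → length xs ≡ length xs′ → xs ++ ys ≡ xs′ ++ ys′ → xs ≡ xs′ × ys ≡ ys′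
++-injective-length [] [] _ eq = refl , eq
++-injective-length (x ∷ xs) (x′ ∷ xs′) len eq with Listₚ.∷-injective eq
... | refl , eq′ with ++-injective-length xs xs′ (ℕₚ.suc-injective len) eq′
...   | refl , eq″ = refl , eq″

-- Decoding runs from the end: once the later queue is known, the degree of the removed node tells
-- how many of its last trees are that node's children.
BFS-injective : ∀ {ts ts′ ds ds′} → BFS ts ds → BFS ts′ ds′ → ds ≡ ds′ → length ts ≡ length ts′ → ts ≡ ts′
BFS-injective done done _ _ = refl
BFS-injective (step {cs} {ts} p) (step {cs′} {ts′} q) eq len
  with Listₚ.∷-injective eq
... | ≡cs , ≡ds with ++-injective-length ts ts′ (ℕₚ.suc-injective len) (BFS-injective p q ≡ds
        (trans (Listₚ.length-++ ts) (trans (cong₂ _+_ (ℕₚ.suc-injective len) ≡cs) (sym (Listₚ.length-++ ts′)))))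
...   | refl , refl = refl

BFS-length : ∀ {ts ds} → BFS ts ds → length ds ≡ size ts
BFS-length done = refl
BFS-length (step {cs} {ts} p) = cong suc (trans (BFS-length p) (trans (size-++ ts cs) (ℕₚ.+-comm (size ts) (size cs))))

BFS-level : ∀ qs {rs ds} → BFS (rs ++ concatMap children qs) ds → BFS (qs ++ rs) (map degree qs ++ ds)
BFS-level [] {rs} p = subst (λ ts → BFS ts _) (Listₚ.++-identityʳ rs) p
BFS-level (node cs ∷ qs) {rs} p = step (subst (λ ts → BFS ts _) (sym (Listₚ.++-assoc qs rs cs))
  (BFS-level qs (subst (λ ts → BFS ts _) (sym (Listₚ.++-assoc rs cs _)) p)))

upperWord lowerWord : List Tree → List Step
upperWord [] = []
upperWord (node cs ∷ ts) = N ∷ upperWord cs ++ E ∷ upperWord ts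
lowerWord [] = []
lowerWord (node cs ∷ ts) = lowerWord ts ++ E ∷ lowerWord cs ++ N ∷ []

upperWord-++ : ∀ ss ts → upperWord (ss ++ ts) ≡ upperWord ss ++ upperWord ts
upperWord-++ [] ts = refl
upperWord-++ (node cs ∷ ss) ts = cong (N ∷_) (trans (cong (λ w → upperWord cs ++ E ∷ w) (upperWord-++ ss ts))
  (sym (Listₚ.++-assoc (upperWord cs) _ _)))

lowerWord-++ : ∀ ss ts → lowerWord (ss ++ ts) ≡ lowerWord ts ++ lowerWord ss
lowerWord-++ [] ts = sym (Listₚ.++-identityʳ _)
lowerWord-++ (node cs ∷ ss) ts = trans (cong (_++ (E ∷ lowerWord cs ++ N ∷ [])) (lowerWord-++ ss ts))
  (Listₚ.++-assoc (lowerWord ts) _ _)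

reverse-upperWord : ∀ ts → reverse (upperWord ts) ≡ lowerWord ts
reverse-upperWord [] = refl
reverse-upperWord (node cs ∷ ts) = begin
  reverse (N ∷ upperWord cs ++ E ∷ upperWord ts)
    ≡⟨ Listₚ.unfold-reverse N (upperWord cs ++ E ∷ upperWord ts) ⟩
  reverse (upperWord cs ++ E ∷ upperWord ts) ++ N ∷ []
    ≡⟨ cong (_++ N ∷ []) (Listₚ.reverse-++ (upperWord cs) _) ⟩
  (reverse (E ∷ upperWord ts) ++ reverse (upperWord cs)) ++ N ∷ []
    ≡⟨ cong (λ w → (w ++ reverse (upperWord cs)) ++ N ∷ []) (Listₚ.unfold-reverse E (upperWord ts)) ⟩
  ((reverse (upperWord ts) ++ E ∷ []) ++ reverse (upperWord cs)) ++ N ∷ []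
    ≡⟨ cong₂ (λ u v → ((u ++ E ∷ []) ++ v) ++ N ∷ []) (reverse-upperWord ts) (reverse-upperWord cs) ⟩
  ((lowerWord ts ++ E ∷ []) ++ lowerWord cs) ++ N ∷ []
    ≡⟨ Listₚ.++-assoc (lowerWord ts ++ E ∷ []) _ _ ⟩
  (lowerWord ts ++ E ∷ []) ++ lowerWord cs ++ N ∷ []
    ≡⟨ Listₚ.++-assoc (lowerWord ts) _ _ ⟩
  lowerWord ts ++ E ∷ lowerWord cs ++ N ∷ []
    ∎
  where open ≡-Reasoning

reverse-lowerWord : ∀ ts → reverse (lowerWord ts) ≡ upperWord ts
reverse-lowerWord ts = trans (cong reverse (sym (reverse-upperWord ts))) (Listₚ.reverse-involutive _)

count-upperWord : ∀ s ts → count s (upperWord ts) ≡ size ts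
count-upperWord _ [] = refl
count-upperWord N (node cs ∷ ts) = cong suc (trans (count-++ N (upperWord cs) _)
  (cong₂ _+_ (count-upperWord N cs) (count-upperWord N ts)))
count-upperWord E (node cs ∷ ts) = trans (count-++ E (upperWord cs) _)
  (trans (cong₂ (λ m n → m + suc n) (count-upperWord E cs) (count-upperWord E ts)) (ℕₚ.+-suc (size cs) (size ts)))

count-lowerWord : ∀ s ts → count s (lowerWord ts) ≡ size ts
count-lowerWord s ts = trans (cong (count s) (sym (reverse-upperWord ts)))
  (trans (count-reverse s (upperWord ts)) (count-upperWord s ts))

rise-upperWord : ∀ t ts → rise t (upperWord ts) ≡ t
rise-upperWord t ts = rise-balanced t (upperWord ts) (trans (count-upperWord N ts) (sym (count-upperWord E ts)))

rise-lowerWord : ∀ t ts → rise t (lowerWord ts) ≡ t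
rise-lowerWord t ts = rise-balanced t (lowerWord ts) (trans (count-lowerWord N ts) (sym (count-lowerWord E ts)))

inSteps-upperWord-++ : ∀ t ss ts → inSteps t (upperWord (ss ++ ts)) ≡ inSteps t (upperWord ss) ++ inSteps t (upperWord ts)
inSteps-upperWord-++ t ss ts = begin
  inSteps t (upperWord (ss ++ ts))                                        ≡⟨ cong (inSteps t) (upperWord-++ ss ts) ⟩
  inSteps t (upperWord ss ++ upperWord ts)                                ≡⟨ inSteps-++ t (upperWord ss) _ ⟩
  inSteps t (upperWord ss) ++ inSteps (rise t (upperWord ss)) (upperWord ts)
    ≡⟨ cong (λ t′ → inSteps t (upperWord ss) ++ inSteps t′ (upperWord ts)) (rise-upperWord t ss) ⟩
  inSteps t (upperWord ss) ++ inSteps t (upperWord ts)                    ∎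
  where open ≡-Reasoning

inSteps-upperWord-∷ : ∀ t cs ts → inSteps t (upperWord (node cs ∷ ts)) ≡
  onLine (ℤ.pred t) N ++ inSteps (ℤ.pred t) (upperWord cs) ++ onLine t E ++ inSteps t (upperWord ts)
inSteps-upperWord-∷ t cs ts = cong (onLine (ℤ.pred t) N ++_)
  (trans (inSteps-++ (ℤ.pred t) (upperWord cs) _)
    (cong (inSteps (ℤ.pred t) (upperWord cs) ++_) (trans
      (cong (λ t → inSteps t (E ∷ upperWord ts)) (rise-upperWord (ℤ.pred t) cs))
      (cong (λ t → onLine t E ++ inSteps t (upperWord ts)) (ℤₚ.suc-pred t)))))

inSteps-upperWord-below : ∀ k ts → inSteps -[1+ k ] (upperWord ts) ≡ []
inSteps-upperWord-below k [] = refl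
inSteps-upperWord-below k (node cs ∷ ts) = trans (inSteps-upperWord-∷ -[1+ k ] cs ts)
  (cong₂ _++_ (inSteps-upperWord-below (suc k) cs) (inSteps-upperWord-below k ts))

inSteps-upperWord-0 : ∀ ts → inSteps (+ 0) (upperWord ts) ≡ replicate (length ts) E
inSteps-upperWord-0 [] = refl
inSteps-upperWord-0 (node cs ∷ ts) = trans (inSteps-upperWord-∷ (+ 0) cs ts)
  (cong₂ (λ u v → u ++ E ∷ v) (inSteps-upperWord-below 0 cs) (inSteps-upperWord-0 ts))

degreesWord : List ℕ → List Step
degreesWord = concatMap (λ d → N ∷ replicate d E)

-- Height 1 is entered by the N that opens a tree and then by one E on the return from each child of
-- its root.
inSteps-upperWord-1 : ∀ ts → inSteps (+ 1) (upperWord ts) ≡ degreesWord (map degree ts)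
inSteps-upperWord-1 [] = refl
inSteps-upperWord-1 (node cs ∷ ts) = trans (inSteps-upperWord-∷ (+ 1) cs ts)
  (cong₂ (λ u v → N ∷ u ++ v) (inSteps-upperWord-0 cs) (inSteps-upperWord-1 ts))

-- The outermost N and E of each tree end at heights 1 and 0 and are not read from height 2 on.
-- Without them the contour word of the children remains, lowered by one.
inSteps-upperWord-suc : ∀ k ts → inSteps (+ suc (suc k)) (upperWord ts) ≡ inSteps (+ suc k) (upperWord (concatMap children ts))
inSteps-upperWord-suc k [] = refl
inSteps-upperWord-suc k (node cs ∷ ts) = begin
  inSteps (+ suc (suc k)) (upperWord (node cs ∷ ts))
    ≡⟨ inSteps-upperWord-∷ (+ suc (suc k)) cs ts ⟩
  inSteps (+ suc k) (upperWord cs) ++ inSteps (+ suc (suc k)) (upperWord ts)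
    ≡⟨ cong (inSteps (+ suc k) (upperWord cs) ++_) (inSteps-upperWord-suc k ts) ⟩
  inSteps (+ suc k) (upperWord cs) ++ inSteps (+ suc k) (upperWord (concatMap children ts))
    ≡⟨ inSteps-upperWord-++ (+ suc k) cs (concatMap children ts) ⟨
  inSteps (+ suc k) (upperWord (cs ++ concatMap children ts))
    ∎
  where open ≡-Reasoning

inSteps-lowerWord-∷ : ∀ t cs ts → inSteps t (lowerWord (node cs ∷ ts)) ≡
  inSteps t (lowerWord ts) ++ onLine (ℤ.suc t) E ++ inSteps (ℤ.suc t) (lowerWord cs) ++ onLine t N
inSteps-lowerWord-∷ t cs ts = trans (inSteps-++ t (lowerWord ts) _) (cong (inSteps t (lowerWord ts) ++_) (trans
  (cong (λ t → inSteps t (E ∷ lowerWord cs ++ N ∷ [])) (rise-lowerWord t ts))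
  (cong (onLine (ℤ.suc t) E ++_) (trans (inSteps-++ (ℤ.suc t) (lowerWord cs) (N ∷ []))
    (cong (inSteps (ℤ.suc t) (lowerWord cs) ++_) (trans
      (cong (λ t → inSteps t (N ∷ [])) (rise-lowerWord (ℤ.suc t) cs))
      (trans (Listₚ.++-identityʳ _) (cong (λ t → onLine t N) (ℤₚ.pred-suc t)))))))))

inSteps-lowerWord-above : ∀ k ts → inSteps (+ suc k) (lowerWord ts) ≡ []
inSteps-lowerWord-above k [] = refl
inSteps-lowerWord-above k (node cs ∷ ts) = trans (inSteps-lowerWord-∷ (+ suc k) cs ts)
  (cong₂ (λ u v → u ++ v ++ []) (inSteps-lowerWord-above k ts) (inSteps-lowerWord-above (suc k) cs))

inSteps-lowerWord-0 : ∀ t → inSteps (+ 0) (lowerWord (t ∷ [])) ≡ N ∷ []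
inSteps-lowerWord-0 (node cs) = trans (inSteps-lowerWord-∷ (+ 0) cs []) (cong (_++ N ∷ []) (inSteps-lowerWord-above 0 cs))

-- Paths as sequences of excursions

Root : Set
Root = Step × Tree

-- The step of a root is the last step of its excursion, by which the path comes back to the
-- diagonal.
rootWord : Root → List Step
rootWord (N , t) = lowerWord (t ∷ [])
rootWord (E , t) = upperWord (t ∷ [])

pathWord : List Root → List Step
pathWord = concatMap rootWord

-- Lower trees are listed from right to left, the order in which the reversed path meets them.
lowers uppers : List Root → List Tree
lowers [] = []
lowers ((N , t) ∷ rs) = lowers rs ++ t ∷ []
lowers ((E , _) ∷ rs) = lowers rs
uppers [] = []
uppers ((N , _) ∷ rs) = uppers rs
uppers ((E , t) ∷ rs) = t ∷ uppers rs

length-lowers : ∀ rs → length (lowers rs) ≡ count N (map proj₁ rs)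
length-lowers [] = refl
length-lowers ((N , t) ∷ rs) = trans (Listₚ.length-++ (lowers rs)) (trans (ℕₚ.+-comm _ 1) (cong suc (length-lowers rs)))
length-lowers ((E , _) ∷ rs) = length-lowers rs

length-uppers : ∀ rs → length (uppers rs) ≡ count E (map proj₁ rs)
length-uppers [] = refl
length-uppers ((N , _) ∷ rs) = length-uppers rs
length-uppers ((E , _) ∷ rs) = cong suc (length-uppers rs)

roots-injective : ∀ rs rs′ → map proj₁ rs ≡ map proj₁ rs′ → lowers rs ≡ lowers rs′ → uppers rs ≡ uppers rs′ → rs ≡ rs′
roots-injective [] [] _ _ _ = refl
roots-injective ((s , t) ∷ rs) ((s′ , t′) ∷ rs′) c l u with Listₚ.∷-injective c
roots-injective ((N , t) ∷ rs) ((N , t′) ∷ rs′) c l u | refl , c′ with Listₚ.∷ʳ-injective (lowers rs) (lowers rs′) l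
... | l′ , refl = cong (_ ∷_) (roots-injective rs rs′ c′ l′ u)
roots-injective ((E , t) ∷ rs) ((E , t′) ∷ rs′) c l u | refl , c′ with Listₚ.∷-injective u
... | refl , u′ = cong (_ ∷_) (roots-injective rs rs′ c′ l u′)

roots-exist : ∀ C ls us → length ls ≡ count N C → length us ≡ count E C →
  ∃ λ rs → map proj₁ rs ≡ C × lowers rs ≡ ls × uppers rs ≡ us
roots-exist [] [] [] _ _ = [] , refl , refl , refl
roots-exist (N ∷ C) ls us ≡N ≡E with initLast ls
... | ls′ ∷ʳ′ t with roots-exist C ls′ us (ℕₚ.suc-injective (trans (ℕₚ.+-comm 1 _) (trans (sym (Listₚ.length-++ ls′)) ≡N))) ≡E
...   | rs , refl , refl , refl = (N , t) ∷ rs , refl , refl , refl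
roots-exist (E ∷ C) ls (t ∷ us) ≡N ≡E with roots-exist C ls us ≡N (ℕₚ.suc-injective ≡E)
... | rs , refl , refl , refl = (E , t) ∷ rs , refl , refl , refl

count-rootWord : ∀ s r → count s (rootWord r) ≡ size (proj₂ r ∷ [])
count-rootWord s (N , t) = count-lowerWord s (t ∷ [])
count-rootWord s (E , t) = count-upperWord s (t ∷ [])

count-pathWord : ∀ s rs → count s (pathWord rs) ≡ size (lowers rs) + size (uppers rs)
count-pathWord _ [] = refl
count-pathWord s (r@(N , t@(node cs)) ∷ rs) = begin
  count s (rootWord r ++ pathWord rs)                        ≡⟨ count-++ s (rootWord r) _ ⟩
  count s (rootWord r) + count s (pathWord rs)               ≡⟨ cong₂ _+_ (count-rootWord s r) (count-pathWord s rs) ⟩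
  size (t ∷ []) + (size (lowers rs) + size (uppers rs))      ≡⟨ ℕₚ.+-assoc (size (t ∷ [])) _ _ ⟨
  size (t ∷ []) + size (lowers rs) + size (uppers rs)        ≡⟨ cong (_+ size (uppers rs)) (trans (ℕₚ.+-comm (size (t ∷ [])) _) (sym (size-++ (lowers rs) _))) ⟩
  size (lowers rs ++ t ∷ []) + size (uppers rs)              ∎
  where open ≡-Reasoning
count-pathWord s (r@(E , t@(node cs)) ∷ rs) = begin
  count s (rootWord r ++ pathWord rs)                        ≡⟨ count-++ s (rootWord r) _ ⟩
  count s (rootWord r) + count s (pathWord rs)               ≡⟨ cong₂ _+_ (count-rootWord s r) (count-pathWord s rs) ⟩
  size (t ∷ []) + (size (lowers rs) + size (uppers rs))      ≡⟨ ℕₚ.+-comm (size (t ∷ [])) _ ⟩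
  size (lowers rs) + size (uppers rs) + size (t ∷ [])        ≡⟨ ℕₚ.+-assoc (size (lowers rs)) _ _ ⟩
  size (lowers rs) + (size (uppers rs) + size (t ∷ []))      ≡⟨ cong (_+_ (size (lowers rs))) (trans (ℕₚ.+-comm _ (size (t ∷ []))) (sym (size-++ (t ∷ []) (uppers rs)))) ⟩
  size (lowers rs) + size (t ∷ uppers rs)                    ∎
  where open ≡-Reasoning

balanced-pathWord : ∀ rs → Balanced (pathWord rs)
balanced-pathWord rs = trans (count-pathWord N rs) (sym (count-pathWord E rs))

inSteps-pathWord-∷ : ∀ t r rs → inSteps t (pathWord (r ∷ rs)) ≡ inSteps t (rootWord r) ++ inSteps t (pathWord rs)
inSteps-pathWord-∷ t r rs = trans (inSteps-++ t (rootWord r) _) (cong (λ t′ → inSteps t (rootWord r) ++ inSteps t′ (pathWord rs))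
  (rise-balanced t (rootWord r) (trans (count-rootWord N r) (sym (count-rootWord E r)))))

inSteps-reverse-pathWord-∷ : ∀ t r rs → inSteps t (reverse (pathWord (r ∷ rs))) ≡ inSteps t (reverse (pathWord rs)) ++ inSteps t (reverse (rootWord r))
inSteps-reverse-pathWord-∷ t r rs = trans (cong (inSteps t) (Listₚ.reverse-++ (rootWord r) (pathWord rs)))
  (trans (inSteps-++ t (reverse (pathWord rs)) _)
    (cong (λ t′ → inSteps t (reverse (pathWord rs)) ++ inSteps t′ (reverse (rootWord r)))
      (rise-balanced t (reverse (pathWord rs)) (reverse-balanced (pathWord rs) (balanced-pathWord rs)))))

inSteps-pathWord-0 : ∀ rs → inSteps (+ 0) (pathWord rs) ≡ map proj₁ rs
inSteps-pathWord-0 [] = refl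
inSteps-pathWord-0 (r@(N , t) ∷ rs) = trans (inSteps-pathWord-∷ (+ 0) r rs) (cong₂ _++_ (inSteps-lowerWord-0 t) (inSteps-pathWord-0 rs))
inSteps-pathWord-0 (r@(E , t) ∷ rs) = trans (inSteps-pathWord-∷ (+ 0) r rs) (cong₂ _++_ (inSteps-upperWord-0 (t ∷ [])) (inSteps-pathWord-0 rs))

inSteps-pathWord-suc : ∀ k rs → inSteps (+ suc k) (pathWord rs) ≡ inSteps (+ suc k) (upperWord (uppers rs))
inSteps-pathWord-suc k [] = refl
inSteps-pathWord-suc k (r@(N , t) ∷ rs) = trans (inSteps-pathWord-∷ (+ suc k) r rs)
  (cong₂ _++_ (inSteps-lowerWord-above k (t ∷ [])) (inSteps-pathWord-suc k rs))
inSteps-pathWord-suc k (r@(E , t) ∷ rs) = begin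
  inSteps (+ suc k) (pathWord (r ∷ rs))
    ≡⟨ inSteps-pathWord-∷ (+ suc k) r rs ⟩
  inSteps (+ suc k) (upperWord (t ∷ [])) ++ inSteps (+ suc k) (pathWord rs)
    ≡⟨ cong (inSteps (+ suc k) (upperWord (t ∷ [])) ++_) (inSteps-pathWord-suc k rs) ⟩
  inSteps (+ suc k) (upperWord (t ∷ [])) ++ inSteps (+ suc k) (upperWord (uppers rs))
    ≡⟨ inSteps-upperWord-++ (+ suc k) (t ∷ []) (uppers rs) ⟨
  inSteps (+ suc k) (upperWord (t ∷ uppers rs))
    ∎
  where open ≡-Reasoning

inSteps-reverse-pathWord-suc : ∀ k rs → inSteps (+ suc k) (reverse (pathWord rs)) ≡ inSteps (+ suc k) (upperWord (lowers rs))
inSteps-reverse-pathWord-suc k [] = refl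
inSteps-reverse-pathWord-suc k (r@(N , t) ∷ rs) = begin
  inSteps (+ suc k) (reverse (pathWord (r ∷ rs)))
    ≡⟨ inSteps-reverse-pathWord-∷ (+ suc k) r rs ⟩
  inSteps (+ suc k) (reverse (pathWord rs)) ++ inSteps (+ suc k) (reverse (lowerWord (t ∷ [])))
    ≡⟨ cong₂ _++_ (inSteps-reverse-pathWord-suc k rs) (cong (inSteps (+ suc k)) (reverse-lowerWord (t ∷ []))) ⟩
  inSteps (+ suc k) (upperWord (lowers rs)) ++ inSteps (+ suc k) (upperWord (t ∷ []))
    ≡⟨ inSteps-upperWord-++ (+ suc k) (lowers rs) (t ∷ []) ⟨
  inSteps (+ suc k) (upperWord (lowers rs ++ t ∷ []))
    ∎
  where open ≡-Reasoning
inSteps-reverse-pathWord-suc k (r@(E , t) ∷ rs) = begin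
  inSteps (+ suc k) (reverse (pathWord (r ∷ rs)))
    ≡⟨ inSteps-reverse-pathWord-∷ (+ suc k) r rs ⟩
  inSteps (+ suc k) (reverse (pathWord rs)) ++ inSteps (+ suc k) (reverse (upperWord (t ∷ [])))
    ≡⟨ cong₂ _++_ (inSteps-reverse-pathWord-suc k rs)
         (trans (cong (inSteps (+ suc k)) (reverse-upperWord (t ∷ []))) (inSteps-lowerWord-above k (t ∷ []))) ⟩
  inSteps (+ suc k) (upperWord (lowers rs)) ++ []
    ≡⟨ Listₚ.++-identityʳ _ ⟩
  inSteps (+ suc k) (upperWord (lowers rs))
    ∎
  where open ≡-Reasoning

reverse-concatMap : ∀ {A B : Set} (f : A → List B) xs → reverse (concatMap f xs) ≡ concatMap (reverse ∘ f) (reverse xs)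
reverse-concatMap f [] = refl
reverse-concatMap f (x ∷ xs) = begin
  reverse (f x ++ concatMap f xs)                                             ≡⟨ Listₚ.reverse-++ (f x) _ ⟩
  reverse (concatMap f xs) ++ reverse (f x)                                   ≡⟨ cong₂ _++_ (reverse-concatMap f xs) (sym (Listₚ.++-identityʳ _)) ⟩
  concatMap (reverse ∘ f) (reverse xs) ++ concatMap (reverse ∘ f) (x ∷ [])    ≡⟨ Listₚ.concatMap-++ (reverse ∘ f) (reverse xs) (x ∷ []) ⟨
  concatMap (reverse ∘ f) (reverse xs ++ x ∷ [])                              ≡⟨ cong (concatMap (reverse ∘ f)) (Listₚ.unfold-reverse x xs) ⟨
  concatMap (reverse ∘ f) (reverse (x ∷ xs))                                  ∎
  where open ≡-Reasoning

applyUpTo-cong : ∀ {A : Set} {f g : ℕ → A} → (∀ i → f i ≡ g i) → ∀ n → applyUpTo f n ≡ applyUpTo g n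
applyUpTo-cong f≗g zero = refl
applyUpTo-cong f≗g (suc n) = cong₂ _∷_ (f≗g 0) (applyUpTo-cong (f≗g ∘ suc) n)

reverse-blockWord : ∀ π → Balanced π → ∀ j → reverse (blockWord π j) ≡ inSteps (+ j) π ++ inSteps (+ suc j) (reverse π)
reverse-blockWord π bal j = begin
  reverse (outSteps (+ suc j) π ++ outSteps (+ j) (reverse π))
    ≡⟨ Listₚ.reverse-++ (outSteps (+ suc j) π) _ ⟩
  reverse (outSteps (+ j) (reverse π)) ++ reverse (outSteps (+ suc j) π)
    ≡⟨ cong₂ (λ u v → reverse u ++ reverse v) (inSteps-reverse-balanced (+ j) π bal)
         (trans (inSteps-reverse-balanced (+ suc j) (reverse π) (reverse-balanced π bal)) (cong (outSteps (+ suc j)) (Listₚ.reverse-involutive π))) ⟨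
  reverse (reverse (inSteps (+ j) π)) ++ reverse (reverse (inSteps (+ suc j) (reverse π)))
    ≡⟨ cong₂ _++_ (Listₚ.reverse-involutive (inSteps (+ j) π)) (Listₚ.reverse-involutive (inSteps (+ suc j) (reverse π))) ⟩
  inSteps (+ j) π ++ inSteps (+ suc j) (reverse π)
    ∎
  where open ≡-Reasoning

degreesWord-++ : ∀ ds es → degreesWord (ds ++ es) ≡ degreesWord ds ++ degreesWord es
degreesWord-++ = Listₚ.concatMap-++ _

-- This is what block j + 1 contributes to the reversed word: upper nodes of depth j together with
-- lower nodes of depth j + 1, roots having depth 0.
levelWord : List Tree → List Tree → ℕ → List Step
levelWord ls us j = inSteps (+ suc j) (upperWord us) ++ inSteps (+ suc (suc j)) (upperWord ls)

-- Each `levelWord` finishes one breadth-first level with its upper nodes and begins the next with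
-- its lower ones, so the leading word of the lower roots completes the first level. Passing to the
-- children loses at least one node while any is left, so n levels exhaust n nodes.
BFS-levels : ∀ n ls us → size ls + size us ≤ n →
  ∃ λ ds → BFS (ls ++ us) ds × degreesWord (map degree ls) ++ concat (applyUpTo (levelWord ls us) n) ≡ degreesWord ds
BFS-levels zero [] [] _ = [] , done , refl
BFS-levels zero (node _ ∷ _) _ ()
BFS-levels zero [] (node _ ∷ _) ()
BFS-levels (suc n) ls us size≤ with BFS-levels n (concatMap children ls) (concatMap children us) (smaller ls us size≤)
  where
  smaller : ∀ ls us → size ls + size us ≤ suc n → size (concatMap children ls) + size (concatMap children us) ≤ n
  smaller [] [] _ = z≤n
  smaller (node cs ∷ ls) us (s≤s size≤) = ℕₚ.≤-trans (ℕₚ.+-mono-≤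
    (ℕₚ.≤-trans (ℕₚ.≤-reflexive (size-++ cs _)) (ℕₚ.+-monoʳ-≤ (size cs) (ℕₚ.m+n≤o⇒n≤o (length ls) (ℕₚ.≤-reflexive (sym (size-children ls))))))
    (ℕₚ.m+n≤o⇒n≤o (length us) (ℕₚ.≤-reflexive (sym (size-children us))))) size≤
  smaller [] (node cs ∷ us) (s≤s size≤) = ℕₚ.≤-trans
    (ℕₚ.≤-trans (ℕₚ.≤-reflexive (size-++ cs _)) (ℕₚ.+-monoʳ-≤ (size cs) (ℕₚ.m+n≤o⇒n≤o (length us) (ℕₚ.≤-reflexive (sym (size-children us)))))) size≤
... | ds , bfs , eq = map degree (ls ++ us) ++ ds , bfs′ , (begin
  degreesWord (map degree ls) ++ (inSteps (+ 1) (upperWord us) ++ inSteps (+ 2) (upperWord ls)) ++ concat (applyUpTo (levelWord ls us ∘ suc) n)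
    ≡⟨ cong (λ w → degreesWord (map degree ls) ++ w ++ concat (applyUpTo (levelWord ls us ∘ suc) n))
         (cong₂ _++_ (inSteps-upperWord-1 us) (trans (inSteps-upperWord-suc 0 ls) (inSteps-upperWord-1 (concatMap children ls)))) ⟩
  degreesWord (map degree ls) ++ (degreesWord (map degree us) ++ degreesWord (map degree ls′)) ++ concat (applyUpTo (levelWord ls us ∘ suc) n)
    ≡⟨ cong (λ w → degreesWord (map degree ls) ++ (degreesWord (map degree us) ++ degreesWord (map degree ls′)) ++ concat w)
         (applyUpTo-cong (λ j → cong₂ _++_ (inSteps-upperWord-suc j us) (inSteps-upperWord-suc (suc j) ls)) n) ⟩
  degreesWord (map degree ls) ++ (degreesWord (map degree us) ++ degreesWord (map degree ls′)) ++ concat (applyUpTo (levelWord ls′ us′) n)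
    ≡⟨ cong (degreesWord (map degree ls) ++_) (trans (Listₚ.++-assoc (degreesWord (map degree us)) _ _) (cong (degreesWord (map degree us) ++_) eq)) ⟩
  degreesWord (map degree ls) ++ degreesWord (map degree us) ++ degreesWord ds
    ≡⟨ Listₚ.++-assoc (degreesWord (map degree ls)) _ _ ⟨
  (degreesWord (map degree ls) ++ degreesWord (map degree us)) ++ degreesWord ds
    ≡⟨ cong (_++ degreesWord ds) (trans (cong degreesWord (Listₚ.map-++ degree ls us)) (degreesWord-++ (map degree ls) _)) ⟨
  degreesWord (map degree (ls ++ us)) ++ degreesWord ds
    ≡⟨ degreesWord-++ (map degree (ls ++ us)) ds ⟨
  degreesWord (map degree (ls ++ us) ++ ds)
    ∎)
  where
  open ≡-Reasoning
  ls′ = concatMap children ls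
  us′ = concatMap children us
  bfs′ : BFS (ls ++ us) (map degree (ls ++ us) ++ ds)
  bfs′ = subst (λ ts → BFS ts (map degree (ls ++ us) ++ ds)) (Listₚ.++-identityʳ (ls ++ us))
    (BFS-level (ls ++ us) (subst (λ ts → BFS ts ds) (sym (Listₚ.concatMap-++ children ls us)) bfs))

reverse-blockWords : ∀ n rs → size (lowers rs) + size (uppers rs) ≤ n →
  ∃ λ ds → BFS (lowers rs ++ uppers rs) ds × reverse (blockWords n (pathWord rs)) ≡ map proj₁ rs ++ degreesWord ds
reverse-blockWords n rs size≤ with BFS-levels n (lowers rs) (uppers rs) size≤
... | ds , bfs , eq = ds , bfs , (begin
  reverse (concatMap (blockWord π) (downFrom (suc n)))
    ≡⟨ reverse-concatMap (blockWord π) (downFrom (suc n)) ⟩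
  concatMap (reverse ∘ blockWord π) (reverse (downFrom (suc n)))
    ≡⟨ cong (concatMap (reverse ∘ blockWord π)) (Listₚ.reverse-downFrom (suc n)) ⟩
  concatMap (reverse ∘ blockWord π) (upTo (suc n))
    ≡⟨ Listₚ.concatMap-cong (reverse-blockWord π (balanced-pathWord rs)) (upTo (suc n)) ⟩
  (inSteps (+ 0) π ++ inSteps (+ 1) (reverse π)) ++ concatMap word (applyUpTo suc n)
    ≡⟨ cong₂ _++_ (cong₂ _++_ (inSteps-pathWord-0 rs) (trans (inSteps-reverse-pathWord-suc 0 rs) (inSteps-upperWord-1 (lowers rs))))
         (cong concat (trans (Listₚ.map-applyUpTo suc word n)
           (applyUpTo-cong (λ j → cong₂ _++_ (inSteps-pathWord-suc j rs) (inSteps-reverse-pathWord-suc (suc j) rs)) n))) ⟩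
  (map proj₁ rs ++ degreesWord (map degree (lowers rs))) ++ concat (applyUpTo (levelWord (lowers rs) (uppers rs)) n)
    ≡⟨ Listₚ.++-assoc (map proj₁ rs) _ _ ⟩
  map proj₁ rs ++ degreesWord (map degree (lowers rs)) ++ concat (applyUpTo (levelWord (lowers rs) (uppers rs)) n)
    ≡⟨ cong (map proj₁ rs ++_) eq ⟩
  map proj₁ rs ++ degreesWord ds
    ∎)
  where
  open ≡-Reasoning
  π = pathWord rs
  word : ℕ → List Step
  word j = inSteps (+ j) π ++ inSteps (+ suc j) (reverse π)

-- The rest of a path on which length fs nested excursions are still open.
afterUpper afterLower : List (List Tree) → List Root → List Step
afterUpper [] rs = pathWord rs
afterUpper (f ∷ fs) rs = upperWord f ++ E ∷ afterUpper fs rs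
afterLower [] rs = pathWord rs
afterLower (f ∷ fs) rs = lowerWord f ++ N ∷ afterLower fs rs

-- The recursive call returns, for each open excursion, the forest still to be traversed inside it;
-- an opening step turns the innermost one into the children of a new node. At height 0 the next
-- step decides the side, hence the mutual recursion.
parseUpper : ∀ h w → h + count N w ≡ count E w → ∃ λ fs → ∃ λ rs → length fs ≡ h × afterUpper fs rs ≡ w
parseLower : ∀ h w → h + count E w ≡ count N w → ∃ λ fs → ∃ λ rs → length fs ≡ h × afterLower fs rs ≡ w
parseUpper zero [] _ = [] , [] , refl , refl
parseUpper zero (E ∷ w) c with parseLower 1 w (sym c)
... | f ∷ [] , rs , refl , refl = [] , (N , node f) ∷ rs , refl , cong (E ∷_) (Listₚ.++-assoc (lowerWord f) _ _)
parseUpper (suc h) (E ∷ w) c with parseUpper h w (ℕₚ.suc-injective c)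
... | fs , rs , refl , refl = [] ∷ fs , rs , refl , refl
parseUpper h (N ∷ w) c with parseUpper (suc h) w (trans (sym (ℕₚ.+-suc h _)) c)
... | f ∷ [] , rs , refl , refl = [] , (E , node f) ∷ rs , refl , cong (N ∷_) (Listₚ.++-assoc (upperWord f) _ _)
... | f ∷ g ∷ fs , rs , refl , refl = (node f ∷ g) ∷ fs , rs , refl , cong (N ∷_) (Listₚ.++-assoc (upperWord f) _ _)
parseLower zero [] _ = [] , [] , refl , refl
parseLower zero (N ∷ w) c with parseUpper 1 w (sym c)
... | f ∷ [] , rs , refl , refl = [] , (E , node f) ∷ rs , refl , cong (N ∷_) (Listₚ.++-assoc (upperWord f) _ _)
parseLower (suc h) (N ∷ w) c with parseLower h w (ℕₚ.suc-injective c)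
... | fs , rs , refl , refl = [] ∷ fs , rs , refl , refl
parseLower h (E ∷ w) c with parseLower (suc h) w (trans (sym (ℕₚ.+-suc h _)) c)
... | f ∷ [] , rs , refl , refl = [] , (N , node f) ∷ rs , refl , cong (E ∷_) (Listₚ.++-assoc (lowerWord f) _ _)
-- A lower word runs through its trees from right to left, so the node met first is the last of its
-- siblings.
... | f ∷ g ∷ fs , rs , refl , refl = (g ++ node f ∷ []) ∷ fs , rs , refl ,
  trans (cong (_++ N ∷ afterLower fs rs) (lowerWord-++ g (node f ∷ [])))
    (cong (E ∷_) (trans (cong (_++ N ∷ afterLower fs rs) (Listₚ.++-assoc (lowerWord f) (N ∷ []) (lowerWord g)))
      (Listₚ.++-assoc (lowerWord f) (N ∷ lowerWord g) _)))

pathWord-surjective : ∀ w → Balanced w → ∃ λ rs → pathWord rs ≡ w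
pathWord-surjective w bal with parseUpper 0 w bal
... | [] , rs , refl , eq = rs , eq

-- Ballot words

count-N-replicate-E : ∀ d → count N (replicate d E) ≡ 0
count-N-replicate-E zero = refl
count-N-replicate-E (suc d) = count-N-replicate-E d

count-E-replicate-E : ∀ d → count E (replicate d E) ≡ d
count-E-replicate-E zero = refl
count-E-replicate-E (suc d) = cong suc (count-E-replicate-E d)

count-N≡0 : ∀ w → count N w ≡ 0 → w ≡ replicate (length w) E
count-N≡0 [] _ = refl
count-N≡0 (E ∷ w) none = cong (E ∷_) (count-N≡0 w none)

count-degreesWord : ∀ ds → count N (degreesWord ds) ≡ length ds
count-degreesWord [] = refl
count-degreesWord (d ∷ ds) = cong suc (trans (count-++ N (replicate d E) _) (cong₂ _+_ (count-N-replicate-E d) (count-degreesWord ds)))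

-- A degree word is empty or starts with N. With the number x of N's in C fixed, the cut must
-- therefore fall just before N number x + 1, or at the end.
split-unique : ∀ C C′ ds ds′ → count N C ≡ count N C′ → C ++ degreesWord ds ≡ C′ ++ degreesWord ds′ →
  C ≡ C′ × degreesWord ds ≡ degreesWord ds′
split-unique [] [] ds ds′ _ eq = refl , eq
split-unique [] (E ∷ C′) [] ds′ _ ()
split-unique [] (E ∷ C′) (_ ∷ _) ds′ _ ()
split-unique (E ∷ C) [] ds [] _ ()
split-unique (E ∷ C) [] ds (_ ∷ _) _ ()
split-unique (N ∷ C) (N ∷ C′) ds ds′ c eq with split-unique C C′ ds ds′ (ℕₚ.suc-injective c) (Listₚ.∷-injectiveʳ eq)
... | refl , eq′ = refl , eq′
split-unique (E ∷ C) (E ∷ C′) ds ds′ c eq with split-unique C C′ ds ds′ c (Listₚ.∷-injectiveʳ eq)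
... | refl , eq′ = refl , eq′

degreesWord-injective : ∀ ds ds′ → degreesWord ds ≡ degreesWord ds′ → ds ≡ ds′
degreesWord-injective [] [] _ = refl
degreesWord-injective (d ∷ ds) (d′ ∷ ds′) eq
  with split-unique (replicate d E) (replicate d′ E) ds ds′ (trans (count-N-replicate-E d) (sym (count-N-replicate-E d′))) (Listₚ.∷-injectiveʳ eq)
... | d≡d′ , eq′ = cong₂ _∷_
  (trans (sym (Listₚ.length-replicate d)) (trans (cong length d≡d′) (Listₚ.length-replicate d′)))
  (degreesWord-injective ds ds′ eq′)

split-exists : ∀ x w → x ≤ count N w → ∃ λ C → ∃ λ ds → w ≡ C ++ degreesWord ds × count N C ≡ x
split-exists zero [] _ = [] , [] , refl , refl
split-exists x (E ∷ w) x≤ with split-exists x w x≤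
... | C , ds , refl , c = E ∷ C , ds , refl , c
split-exists (suc x) (N ∷ w) (s≤s x≤) with split-exists x w x≤
... | C , ds , refl , c = N ∷ C , ds , refl , cong suc c
-- Cutting the rest at 0 leaves only E's before its next N; their number is the degree of the node
-- that starts here.
split-exists zero (N ∷ w) _ with split-exists 0 w z≤n
... | C , ds , refl , c = [] , length C ∷ ds , cong (λ u → N ∷ u ++ degreesWord ds) (count-N≡0 C c) , refl

-- A condition on the reversed word: reverse w stays weakly above the diagonal and ends at height h.
data Ballot : ℕ → List Step → Set where
  []  : Ballot 0 []
  N∷_ : ∀ {h w} → Ballot h w → Ballot (suc h) (N ∷ w)
  E∷_ : ∀ {h w} → Ballot (suc h) w → Ballot h (E ∷ w)

ballot-count : ∀ {h w} → Ballot h w → count N w ≡ h + count E w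
ballot-count [] = refl
ballot-count (N∷ b) = cong suc (ballot-count b)
ballot-count {h} (E∷ b) = trans (ballot-count b) (sym (ℕₚ.+-suc h _))

ballot-++⁺ : ∀ h C {w} → Ballot (h + count E C) w → Ballot (h + count N C) (C ++ w)
ballot-++⁺ h [] b = b
ballot-++⁺ h (N ∷ C) {w} b = subst (λ k → Ballot k (N ∷ C ++ w)) (sym (ℕₚ.+-suc h (count N C))) (N∷ ballot-++⁺ h C b)
ballot-++⁺ h (E ∷ C) {w} b = E∷ ballot-++⁺ (suc h) C (subst (λ k → Ballot k w) (ℕₚ.+-suc h (count E C)) b)

ballot-++⁻ : ∀ {h} C {w} → Ballot h (C ++ w) → ∃ λ k → Ballot k w × h + count E C ≡ k + count N C
ballot-++⁻ [] b = _ , b , refl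
ballot-++⁻ (N ∷ C) (N∷ b) with ballot-++⁻ C b
... | k , b′ , eq = k , b′ , trans (cong suc eq) (sym (ℕₚ.+-suc k _))
ballot-++⁻ {h} (E ∷ C) (E∷ b) with ballot-++⁻ C b
... | k , b′ , eq = k , b′ , trans (ℕₚ.+-suc h _) eq

-- A prefix of β, reversed, is a suffix of the reversed word, and a suffix of a `Ballot` word is
-- again one.
ballot-prefix : ∀ {h} β → Ballot h (reverse β) → ∀ k → count E (take k β) ≤ count N (take k β)
ballot-prefix β b k with ballot-++⁻ (reverse (drop k β))
  (subst (Ballot _) (trans (cong reverse (sym (Listₚ.take++drop≡id k β))) (Listₚ.reverse-++ (take k β) (drop k β))) b)
... | h′ , b′ , _ = subst₂ _≤_ (count-reverse E (take k β)) (count-reverse N (take k β))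
  (ℕₚ.≤-trans (ℕₚ.m≤n+m _ h′) (ℕₚ.≤-reflexive (sym (ballot-count b′))))

ballot-suffixes : ∀ w → (∀ u v → u ++ v ≡ w → count E v ≤ count N v) → ∃ λ h → Ballot h w
ballot-suffixes [] _ = 0 , []
ballot-suffixes (N ∷ w) suffix with ballot-suffixes w (λ u v eq → suffix (N ∷ u) v (cong (N ∷_) eq))
... | h , b = suc h , N∷ b
ballot-suffixes (E ∷ w) suffix with ballot-suffixes w (λ u v eq → suffix (E ∷ u) v (cong (E ∷_) eq))
... | suc h , b = h , E∷ b
... | zero , b  = ⊥-elim (ℕₚ.<-irrefl (sym (ballot-count b)) (suffix [] (E ∷ w) refl))

take-length-++ : ∀ {A : Set} (xs ys : List A) → take (length xs) (xs ++ ys) ≡ xs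
take-length-++ [] ys = refl
take-length-++ (x ∷ xs) ys = cong (x ∷_) (take-length-++ xs ys)

ballot-reverse : ∀ β → (∀ k → count E (take k β) ≤ count N (take k β)) → ∃ λ h → Ballot h (reverse β)
ballot-reverse β prefix = ballot-suffixes (reverse β) λ u v eq →
  subst₂ _≤_ (count-reverse E v) (count-reverse N v)
    (subst (λ w → count E w ≤ count N w)
      (trans (cong (take (length (reverse v))) (β≡ u v eq)) (take-length-++ (reverse v) (reverse u)))
      (prefix (length (reverse v))))
  where
  β≡ : ∀ u v → u ++ v ≡ reverse β → β ≡ reverse v ++ reverse u
  β≡ u v eq = trans (sym (Listₚ.reverse-involutive β)) (trans (cong reverse (sym eq)) (Listₚ.reverse-++ u v))

-- The height is the length of the queue: N removes a node, and each E adds one of its children.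
BFS-ballot : ∀ {ts ds} → BFS ts ds → Ballot (length ts) (degreesWord ds)
BFS-ballot done = []
BFS-ballot (step {cs} {ts} {ds} p) = N∷ subst (λ k → Ballot k _)
  (trans (cong (_+_ (length ts)) (count-N-replicate-E (length cs))) (ℕₚ.+-identityʳ _))
  (ballot-++⁺ (length ts) (replicate (length cs) E)
    (subst (λ k → Ballot k (degreesWord ds))
      (trans (Listₚ.length-++ ts) (cong (_+_ (length ts)) (sym (count-E-replicate-E (length cs)))))
      (BFS-ballot p)))

-- The forest is rebuilt from the right: the last d trees of the later queue become the children of
-- a new node at the front.
ballot-BFS : ∀ {h} ds → Ballot h (degreesWord ds) → ∃ λ ts → length ts ≡ h × BFS ts ds
ballot-BFS [] [] = [] , refl , done
ballot-BFS (d ∷ ds) (N∷_ {h} b) with ballot-++⁻ (replicate d E) b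
... | k , b′ , eq with ballot-BFS ds b′
...   | ts , refl , bfs = node (drop h ts) ∷ take h ts
  , cong suc (trans (Listₚ.length-take h ts) (ℕₚ.m≤n⇒m⊓n≡m (ℕₚ.m+n≤o⇒m≤o h (ℕₚ.≤-reflexive h+d≡))))
  , subst (λ d → BFS (node (drop h ts) ∷ take h ts) (d ∷ ds))
      (trans (Listₚ.length-drop h ts) (trans (cong (_∸ h) (sym h+d≡)) (ℕₚ.m+n∸m≡n h d)))
      (step (subst (λ ts → BFS ts ds) (sym (Listₚ.take++drop≡id h ts)) bfs))
  where
  h+d≡ : h + d ≡ length ts
  h+d≡ = begin
    h + d                                        ≡⟨ cong (_+_ h) (count-E-replicate-E d) ⟨
    h + count E (replicate d E)                  ≡⟨ eq ⟩
    length ts + count N (replicate d E)          ≡⟨ cong (_+_ (length ts)) (count-N-replicate-E d) ⟩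
    length ts + 0                                ≡⟨ ℕₚ.+-identityʳ _ ⟩
    length ts                                    ∎
    where open ≡-Reasoning

length-count : ∀ w → length w ≡ count N w + count E w
length-count [] = refl
length-count (N ∷ w) = cong suc (length-count w)
length-count (E ∷ w) = trans (cong suc (length-count w)) (sym (ℕₚ.+-suc (count N w) (count E w)))

-- The bijection onto ballot words

record Decomposition (n : ℕ) (π : List Step) : Set where
  field
    roots         : List Root
    degrees       : List ℕ
    path          : pathWord roots ≡ π
    bfs           : BFS (lowers roots ++ uppers roots) degrees
    degreesLength : length degrees ≡ n
    sweep         : reverse (blockWords n π) ≡ map proj₁ roots ++ degreesWord degrees

  rootCount : length (lowers roots ++ uppers roots) ≡ count N (map proj₁ roots) + count E (map proj₁ roots)
  rootCount = trans (Listₚ.length-++ (lowers roots)) (cong₂ _+_ (length-lowers roots) (length-uppers roots))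

  -- Hence the word alone tells how many excursions are lower ones, and thereby where the degree
  -- part begins.
  northCount : count N (reverse (blockWords n π)) ≡ count N (map proj₁ roots) + n
  northCount = trans (cong (count N) sweep) (trans (count-++ N (map proj₁ roots) _)
    (cong (_+_ (count N (map proj₁ roots))) (trans (count-degreesWord degrees) degreesLength)))

decompose : ∀ n π → IsL n π → Decomposition n π
decompose n π (cN , cE) with pathWord-surjective π (trans cN (sym cE))
... | rs , refl with reverse-blockWords n rs (ℕₚ.≤-reflexive (trans (sym (count-pathWord N rs)) cN))
...   | ds , bfs , eq = record
  { roots = rs ; degrees = ds ; path = refl ; bfs = bfs
  ; degreesLength = trans (BFS-length bfs) (trans (size-++ (lowers rs) _) (trans (sym (count-pathWord N rs)) cN))
  ; sweep = eq }

blockWords-IsB : ∀ n π → IsL n π → IsB n (blockWords n π)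
blockWords-IsB n π isL = lengthEq , ballot-prefix β ballot
  where
  open Decomposition (decompose n π isL)
  open ≡-Reasoning
  β = blockWords n π
  C = map proj₁ roots
  x = count N C
  -- The degree part has height x + e, where e is the number of upper excursions. Prepending C takes
  -- away its e E's and adds its x N's.
  ballot : Ballot (x + x) (reverse β)
  ballot = subst (Ballot (x + x)) (sym sweep)
    (ballot-++⁺ x C (subst (λ k → Ballot k (degreesWord degrees)) rootCount (BFS-ballot bfs)))
  eastCount : count E (reverse β) + x ≡ n
  eastCount = ℕₚ.+-cancelˡ-≡ x _ _ (begin
    x + (count E (reverse β) + x)   ≡⟨ cong (_+_ x) (ℕₚ.+-comm _ x) ⟩
    x + (x + count E (reverse β))   ≡⟨ ℕₚ.+-assoc x x _ ⟨
    x + x + count E (reverse β)     ≡⟨ ballot-count ballot ⟨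
    count N (reverse β)             ≡⟨ northCount ⟩
    x + n                           ∎)
  lengthEq : length β ≡ n + n
  lengthEq = begin
    length β                                       ≡⟨ Listₚ.length-reverse β ⟨
    length (reverse β)                             ≡⟨ length-count (reverse β) ⟩
    count N (reverse β) + count E (reverse β)      ≡⟨ cong (_+ count E (reverse β)) (trans northCount (ℕₚ.+-comm x n)) ⟩
    n + x + count E (reverse β)                    ≡⟨ ℕₚ.+-assoc n x _ ⟩
    n + (x + count E (reverse β))                  ≡⟨ cong (_+_ n) (trans (ℕₚ.+-comm x _) eastCount) ⟩
    n + n                                          ∎

blockWords-injective : ∀ n π π′ → IsL n π → IsL n π′ → blockWords n π ≡ blockWords n π′ → π ≡ π′
blockWords-injective n π π′ isL isL′ eq = begin
  π                    ≡⟨ D.path ⟨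
  pathWord D.roots     ≡⟨ cong pathWord roots≡ ⟩
  pathWord D′.roots    ≡⟨ D′.path ⟩
  π′                   ∎
  where
  open ≡-Reasoning
  module D = Decomposition (decompose n π isL)
  module D′ = Decomposition (decompose n π′ isL′)
  C = map proj₁ D.roots
  C′ = map proj₁ D′.roots
  split : C ≡ C′ × degreesWord D.degrees ≡ degreesWord D′.degrees
  split = split-unique C C′ D.degrees D′.degrees
    (ℕₚ.+-cancelʳ-≡ n (count N C) (count N C′) (trans (sym D.northCount) (trans (cong (λ β → count N (reverse β)) eq) D′.northCount)))
    (trans (sym D.sweep) (trans (cong reverse eq) D′.sweep))
  trees≡ : lowers D.roots ++ uppers D.roots ≡ lowers D′.roots ++ uppers D′.roots
  trees≡ = BFS-injective D.bfs D′.bfs (degreesWord-injective D.degrees D′.degrees (proj₂ split))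
    (trans D.rootCount (trans (cong (λ C → count N C + count E C) (proj₁ split)) (sym D′.rootCount)))
  forests≡ : lowers D.roots ≡ lowers D′.roots × uppers D.roots ≡ uppers D′.roots
  forests≡ = ++-injective-length (lowers D.roots) (lowers D′.roots)
    (trans (length-lowers D.roots) (trans (cong (count N) (proj₁ split)) (sym (length-lowers D′.roots)))) trees≡
  roots≡ : D.roots ≡ D′.roots
  roots≡ = roots-injective D.roots D′.roots (proj₁ split) (proj₁ forests≡) (proj₂ forests≡)

-- A word of length 2n with e E's has final height 2n - 2e, so the height is even with half n - e.
half-height : ∀ n h e → h + e + e ≡ n + n → ∃ λ x → x + x ≡ h × x + e ≡ n
half-height n h e eq = n ∸ e , ℕₚ.+-cancelʳ-≡ (e + e) _ _ (begin
  x + x + (e + e)     ≡⟨ ℕₚ.+-assoc x x _ ⟩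
  x + (x + (e + e))   ≡⟨ cong (_+_ x) (ℕₚ.+-assoc x e e) ⟨
  x + (x + e + e)     ≡⟨ cong (λ k → x + (k + e)) x+e≡n ⟩
  x + (n + e)         ≡⟨ cong (_+_ x) (ℕₚ.+-comm n e) ⟩
  x + (e + n)         ≡⟨ ℕₚ.+-assoc x e n ⟨
  x + e + n           ≡⟨ cong (_+ n) x+e≡n ⟩
  n + n               ≡⟨ eq ⟨
  h + e + e           ≡⟨ ℕₚ.+-assoc h e e ⟩
  h + (e + e)         ∎) , x+e≡n
  where
  open ≡-Reasoning
  x = n ∸ e
  e≤n : e ≤ n
  e≤n = ℕₚ.≮⇒≥ λ n<e → ℕₚ.<⇒≱ (ℕₚ.+-mono-< n<e n<e)
    (ℕₚ.≤-trans (ℕₚ.m≤n+m (e + e) h) (ℕₚ.≤-reflexive (trans (sym (ℕₚ.+-assoc h e e)) eq)))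
  x+e≡n : x + e ≡ n
  x+e≡n = ℕₚ.m∸n+n≡m e≤n

-- Cutting off a part C with x N's and e E's leaves a word of height x + e. It encodes that many
-- trees, of which the first x become the lower ones.
ballot-decode : ∀ x w → Ballot (x + x) w → ∃ λ rs → ∃ λ ds →
  w ≡ map proj₁ rs ++ degreesWord ds × BFS (lowers rs ++ uppers rs) ds × count N w ≡ x + length ds
ballot-decode x w b with split-exists x w
  (ℕₚ.≤-trans (ℕₚ.m≤m+n x (x + count E w)) (ℕₚ.≤-reflexive (trans (sym (ℕₚ.+-assoc x x _)) (sym (ballot-count b)))))
... | C , ds , refl , refl with ballot-++⁻ C b
... | k , b′ , eq with ballot-BFS ds b′
... | ts , refl , bfs with roots-exist C (take x ts) (drop x ts)
      (trans (Listₚ.length-take x ts) (ℕₚ.m≤n⇒m⊓n≡m (ℕₚ.m+n≤o⇒m≤o x (ℕₚ.≤-reflexive x+e≡))))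
      (trans (Listₚ.length-drop x ts) (trans (cong (_∸ x) (sym x+e≡)) (ℕₚ.m+n∸m≡n x (count E C))))
  where
  x+e≡ : count N C + count E C ≡ length ts
  x+e≡ = ℕₚ.+-cancelʳ-≡ x _ _ (trans (ℕₚ.+-assoc x _ x) (trans (cong (_+_ x) (ℕₚ.+-comm (count E C) x)) (trans (sym (ℕₚ.+-assoc x x _)) eq)))
... | rs , refl , l , u = rs , ds , refl
  , subst (λ ts → BFS ts ds) (sym (trans (cong₂ _++_ l u) (Listₚ.take++drop≡id x ts))) bfs
  , trans (count-++ N C _) (cong (_+_ x) (count-degreesWord ds))

blockWords-surjective : ∀ n β → IsB n β → ∃ λ π → IsL n π × blockWords n π ≡ β
blockWords-surjective n β (len , prefix) with ballot-reverse β prefix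
... | h , b with half-height n h (count E (reverse β)) (begin
      h + count E (reverse β) + count E (reverse β)    ≡⟨ cong (_+ count E (reverse β)) (ballot-count b) ⟨
      count N (reverse β) + count E (reverse β)        ≡⟨ length-count (reverse β) ⟨
      length (reverse β)                               ≡⟨ Listₚ.length-reverse β ⟩
      length β                                         ≡⟨ len ⟩
      n + n                                            ∎)
  where open ≡-Reasoning
... | x , refl , x+e≡n with ballot-decode x (reverse β) b
... | rs , ds , eq , bfs , cN = pathWord rs , isL , Listₚ.reverse-injective (begin
  reverse (blockWords n (pathWord rs))      ≡⟨ proj₂ (proj₂ sweep) ⟩
  -- The sweep yields some degree sequence of the forest; as a forest has only one, it is the
  -- sequence decoded from β.
  map proj₁ rs ++ degreesWord (proj₁ sweep) ≡⟨ cong (λ ds → map proj₁ rs ++ degreesWord ds) (BFS-functional (proj₁ (proj₂ sweep)) bfs) ⟩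
  map proj₁ rs ++ degreesWord ds            ≡⟨ eq ⟨
  reverse β                                 ∎)
  where
  open ≡-Reasoning
  length≡n : length ds ≡ n
  length≡n = trans (ℕₚ.+-cancelˡ-≡ x _ _ (trans (sym cN) (trans (ballot-count b) (ℕₚ.+-assoc x x _)))) x+e≡n
  size≡n : size (lowers rs) + size (uppers rs) ≡ n
  size≡n = trans (sym (size-++ (lowers rs) _)) (trans (sym (BFS-length bfs)) length≡n)
  isL : IsL n (pathWord rs)
  isL = trans (count-pathWord N rs) size≡n , trans (count-pathWord E rs) size≡n
  sweep = reverse-blockWords n rs (ℕₚ.≤-reflexive size≡n)

theorem4p22 : (n : ℕ) → 1 ≤ n →
    ((π : List Step) → IsL n π → sw n π ≡ zetaC n π)
    × ((π : List Step) → IsL n π → IsB n (sw n π))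
    × ((π π′ : List Step) → IsL n π → IsL n π′ → sw n π ≡ sw n π′ → π ≡ π′)
    × ((β : List Step) → IsB n β → ∃ λ π → IsL n π × sw n π ≡ β)
theorem4p22 n 1≤n
  = (λ π isL@(cN , cE) → trans (sw≡ π isL) (sym (zetaC-blockWords n π (trans cN (sym cE)))))
  , (λ π isL → subst (IsB n) (sym (sw≡ π isL)) (blockWords-IsB n π isL))
  , (λ π π′ isL isL′ eq → blockWords-injective n π π′ isL isL′ (trans (sym (sw≡ π isL)) (trans eq (sw≡ π′ isL′))))
  , λ β isB → let (π , isL , eq) = blockWords-surjective n β isB in π , isL , trans (sw≡ π isL) eq
  where sw≡ = sw-blockWords n 1≤n
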